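{- Let $s,t\ge 1$, $D\ge 3$, and $\ell=2\lceil\log s/\log(D-1)\rceil+3$. Let $\mathcal{G}=\{G_1,\dots,G_t\}$ be an $s$-joined graph family on $n$ vertices. Let $\mathcal{H}$ be a $[t]$-edge-colored graph with $\Delta^{mon}(\mathcal H)\le D$ and $|V(\mathcal H)|\le n-6sD$. Suppose $\mathcal H$ is $\mathcal H_0$-path-constructible with paths of length at least $\ell$, where $\mathcal H_0\subseteq\mathcal H$ is a rooted graph, and there exists a $(2s,D)$-good embedding $\phi:\mathcal H_0\hookrightarrow\mathcal G$. Then there exist a rooted structure on $\mathcal H$ whose root set contains the roots of $\mathcal H_0$, and a $(2s,D)$-good embedding $\phi':\mathcal H\hookrightarrow\mathcal G$ extending $\phi$.
   Context: $\mathcal G=\{G_1,\dots,G_t\}$ is a family of graphs on a common vertex set $V$, $|V|=n$. Its auxiliary bipartite graph has parts $V\times[t]$ and $V$, with $(u,i)\sim v$ iff $uv\in E(G_i)$; $\mathcal G$ is $s$-joined if for all $X\subseteq V\times[t]$, $Y\subseteq V$ with $|X|,|Y|\ge s$ some $(u,i)\in X$, $v\in Y$ are adjacent. A $[t]$-edge-colored graph $\mathcal H$ has edges colored from $[t]$; $H_i$ is its spanning subgraph of color-$i$ edges; $\Delta^{mon}(\mathcal H)=\max_i\Delta(H_i)$. An embedding $\phi:\mathcal H\hookrightarrow\mathcal G$ is an injective map $V(\mathcal H)\to V$ with $\phi(u)\phi(v)\in E(G_i)$ for every edge $uv$ of color $i$. For $X\subseteq V\times[t]$, $\Gamma_{\mathcal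 G}(X)=\bigcup_{(v,i)\in X}\Gamma_{G_i}(v)$, where $\Gamma_{G_i}(v)$ is the neighbourhood of $v$ in $G_i$. A rooted graph is a graph with a distinguished set of roots such that every non-root vertex $h$ has a unique path to the root set meeting it only at its last vertex; the neighbour of $h$ on this path is its parent. For an embedding $\phi$ of a rooted $\mathcal H$ and $X\subseteq V\times[t]$, $R(X,\phi)=|\Gamma_{\mathcal G}(X)\setminus\phi(V(\mathcal H))|-\sum_{(v,i)\in X}[D-\deg_{H_i}(\phi^{ -1}(v))]-|P_\phi(\mathcal H)\cap X|$, where $\deg_{H_i}(\phi^{ -1}(v))=0$ if $v\notin\phi(V(\mathcal H))$, and $P_\phi(\mathcal H)$ is the set of pairs $(\phi(h),i)$ with $h$ a non-root vertex and $i$ the color of the edge from $h$ to its parent. $\phi$ is $(s,D)$-good if $R(X,\phi)\ge 0$ for every $X\subseteq V\times[t]$ with $|X|\le s$. $\mathcal H$ is $\mathcal H_0$-path-constructible if there are edge-disjoint paths $P_1,\dots,P_k$ with $E(\mathcal H)=E(\mathcal H_0)\cup\bigcup_j E(P_j)$, such that for each $i$ the internal vertices of $P_i$ are disjoint from $V(\mathcal H_0)\cup\bigcup_{j<i}V(P_j)$ and at least one endpoint of $P_i$ lies in $V(\mathcal H_0)\cup\bigcup_{j<i}V(P_j)$. -}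

module Defs where

open import Data.Nat using (ℕ; zero; suc; _+_; _*_; _∸_; _^_; _≤_; _<_)
open import Data.Integer as ℤ using (ℤ; +_; _-_)
open import Data.Fin using (Fin; toℕ) renaming (zero to fz; suc to fs)
open import Data.Fin.Properties using (_≟_)
open import Data.Bool using (Bool; true; false; T; _∧_; _∨_; not; if_then_else_)
open import Data.Maybe using (Maybe; just; nothing; is-just)
open import Data.List using (List; []; _∷_; _++_; length)
open import Data.List.Membership.Propositional using (_∈_)
open import Data.List.Relation.Unary.All using (All)
open import Data.List.Relation.Unary.Unique.Propositional using (Unique)
open import Data.Product using (Σ; _×_; _,_)
open import Data.Sum using (_⊎_)
open import Data.Empty using (⊥)
open import Relation.Nullary using (¬_)
open import Relation.Nullary.Decidable using (⌊_⌋)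
open import Relation.Binary.PropositionalEquality using (_≡_; _≢_)

sumFin : ∀ {k} → (Fin k → ℕ) → ℕ
sumFin {zero}  f = 0
sumFin {suc k} f = f fz + sumFin (λ i → f (fs i))

sumFinℤ : ∀ {k} → (Fin k → ℤ) → ℤ
sumFinℤ {zero}  f = + 0
sumFinℤ {suc k} f = f fz ℤ.+ sumFinℤ (λ i → f (fs i))

anyFin : ∀ {k} → (Fin k → Bool) → Bool
anyFin {zero}  p = false
anyFin {suc k} p = p fz ∨ anyFin (λ i → p (fs i))

ind : Bool → ℕ
ind b = if b then 1 else 0

count : ∀ {k} → (Fin k → Bool) → ℕ
count p = sumFin (λ i → ind (p i))

count2 : ∀ {n t} → (Fin n → Fin t → Bool) → ℕ
count2 X = sumFin (λ v → count (X v))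

_==_ : ∀ {k} → Fin k → Fin k → Bool
a == b = ⌊ a ≟ b ⌋

isCol : ∀ {t} → Maybe (Fin t) → Fin t → Bool
isCol (just c) i = c == i
isCol nothing  i = false

record GraphFamily (n t : ℕ) : Set where
  field
    adj    : Fin t → Fin n → Fin n → Bool
    sym    : ∀ i u v → adj i u v ≡ adj i v u
    irrefl : ∀ i u → adj i u u ≡ false
open GraphFamily public

Γ : ∀ {n t} → GraphFamily n t → (Fin n → Fin t → Bool) → Fin n → Bool
Γ G X w = anyFin (λ v → anyFin (λ i → X v i ∧ adj G i v w))

SJoined : ∀ {n t} → ℕ → GraphFamily n t → Set
SJoined {n} {t} s G =
  (X : Fin n → Fin t → Bool) (Y : Fin n → Bool) →
  s ≤ count2 X → s ≤ count Y →
  Σ (Fin n) λ u → Σ (Fin t) λ i → Σ (Fin n) λ v →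
    T (X u i) × T (Y v) × T (adj G i u v)

-- A [t]-edge-coloured (simple) graph on vertex set Fin m.
-- col a b = just i iff ab is an edge of colour i; nothing iff not an edge.

record ColGraph (m t : ℕ) : Set where
  field
    col    : Fin m → Fin m → Maybe (Fin t)
    csym   : ∀ a b → col a b ≡ col b a
    cirref : ∀ a → col a a ≡ nothing
open ColGraph public

IsEdge : ∀ {m t} → ColGraph m t → Fin m → Fin m → Set
IsEdge H a b = T (is-just (col H a b))

degH : ∀ {m t} → ColGraph m t → Fin t → Fin m → ℕ
degH H i h = count (λ h' → isCol (col H h h') i)

MaxMonDeg≤ : ∀ {m t} → ColGraph m t → ℕ → Set
MaxMonDeg≤ H D = ∀ i h → degH H i h ≤ D

-- A subgraph of H: vertex set vset, edge set eset (edges keep their H-colour).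
record Sub {m t} (H : ColGraph m t) : Set where
  field
    vset     : Fin m → Bool
    eset     : Fin m → Fin m → Bool
    esym     : ∀ a b → eset a b ≡ eset b a
    e⊆H      : ∀ a b → T (eset a b) → IsEdge H a b
    e-ends   : ∀ a b → T (eset a b) → T (vset a) × T (vset b)
open Sub public

fullSub : ∀ {m t} (H : ColGraph m t) → Sub H
fullSub H = record
  { vset = λ _ → true
  ; eset = λ a b → is-just (col H a b)
  ; esym = λ a b → Relation.Binary.PropositionalEquality.cong is-just (csym H a b)
  ; e⊆H = λ a b e → e
  ; e-ends = λ a b _ → _ , _ }
  where open import Data.Unit using (tt)

degSub : ∀ {m t} {H : ColGraph m t} → Sub H → Fin t → Fin m → ℕ
degSub {H = H} S i h = count (λ h' → eset S h h' ∧ isCol (col H h h') i)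

pairs : ∀ {A : Set} → List A → List (A × A)
pairs []           = []
pairs (x ∷ [])     = []
pairs (x ∷ y ∷ xs) = (x , y) ∷ pairs (y ∷ xs)

rootPathVerts : ∀ {A : Set} → A → List A → A → List A
rootPathVerts h ys r = h ∷ (ys ++ (r ∷ []))

IsRootPath : ∀ {m t} {H : ColGraph m t} → Sub H → (Fin m → Bool) →
             Fin m → List (Fin m) → Fin m → Set
IsRootPath S root h ys r =
  Unique (rootPathVerts h ys r) ×
  All (λ e → T (eset S (Data.Product.proj₁ e) (Data.Product.proj₂ e)))
      (pairs (rootPathVerts h ys r)) ×
  T (root r) ×
  All (λ x → T (not (root x))) (h ∷ ys)

secondVertex : ∀ {A : Set} → List A → A → A
secondVertex []      r = r
secondVertex (y ∷ _) r = y

record Rooting {m t} {H : ColGraph m t} (S : Sub H) : Set where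
  field
    root    : Fin m → Bool
    root⊆V  : ∀ h → T (root h) → T (vset S h)
    parent  : Fin m → Fin m
    uniquePath : ∀ h → T (vset S h) → T (not (root h)) →
      Σ (List (Fin m)) λ ys → Σ (Fin m) λ r →
        IsRootPath S root h ys r ×
        (∀ ys' r' → IsRootPath S root h ys' r' → (ys' ≡ ys) × (r' ≡ r)) ×
        (parent h ≡ secondVertex ys r)
open Rooting public

-- Embeddings of a subgraph S of H into the family G
-- (φ is only relevant on vset S).

record IsEmbedding {m n t} {H : ColGraph m t} (S : Sub H)
                   (G : GraphFamily n t) (φ : Fin m → Fin n) : Set where
  field
    inj   : ∀ a b → T (vset S a) → T (vset S b) → φ a ≡ φ b → a ≡ b
    edges : ∀ a b i → T (eset S a b) → col H a b ≡ just i →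
            T (adj G i (φ a) (φ b))
open IsEmbedding public

inImage : ∀ {m n t} {H : ColGraph m t} → Sub H → (Fin m → Fin n) → Fin n → Bool
inImage S φ v = anyFin (λ h → vset S h ∧ (φ h == v))

-- deg_{S_i}(φ^{-1}(v)), which is 0 if v ∉ φ(V(S))  (φ injective on V(S))
degPre : ∀ {m n t} {H : ColGraph m t} → Sub H → (Fin m → Fin n) →
         Fin t → Fin n → ℕ
degPre S φ i v = sumFin (λ h → if vset S h ∧ (φ h == v) then degSub S i h else 0)

inP : ∀ {m n t} {H : ColGraph m t} {S : Sub H} → Rooting S →
      (Fin m → Fin n) → Fin n → Fin t → Bool
inP {H = H} {S} Rt φ v i =
  anyFin (λ h → vset S h ∧ not (root Rt h) ∧ (φ h == v) ∧
                isCol (col H h (parent Rt h)) i)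

Rval : ∀ {m n t} {H : ColGraph m t} {S : Sub H} → Rooting S →
       GraphFamily n t → (Fin m → Fin n) → ℕ →
       (Fin n → Fin t → Bool) → ℤ
Rval {S = S} Rt G φ D X =
  (+ count (λ w → Γ G X w ∧ not (inImage S φ w)))
  - sumFinℤ (λ v → sumFinℤ (λ i →
        if X v i then (+ D) - (+ degPre S φ i v) else + 0))
  - (+ count2 (λ v i → X v i ∧ inP Rt φ v i))

Good : ∀ {m n t} {H : ColGraph m t} {S : Sub H} → Rooting S →
       GraphFamily n t → (Fin m → Fin n) → ℕ → ℕ → Set
Good {n = n} {t = t} Rt G φ s D =
  (X : Fin n → Fin t → Bool) → count2 X ≤ s → + 0 ℤ.≤ Rval Rt G φ D X

record PathData (m : ℕ) : Set where
  constructor mkPath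
  field
    start : Fin m
    inner : List (Fin m)
    end   : Fin m
open PathData public

pverts : ∀ {m} → PathData m → List (Fin m)
pverts p = start p ∷ (inner p ++ (end p ∷ []))

plength : ∀ {m} → PathData m → ℕ
plength p = suc (length (inner p))

IsPathIn : ∀ {m t} → ColGraph m t → PathData m → Set
IsPathIn H p =
  Unique (pverts p) ×
  All (λ e → IsEdge H (Data.Product.proj₁ e) (Data.Product.proj₂ e)) (pairs (pverts p))

EdgeOf : ∀ {m} → PathData m → Fin m → Fin m → Set
EdgeOf p a b = ((a , b) ∈ pairs (pverts p)) ⊎ ((b , a) ∈ pairs (pverts p))

PathConstructible : ∀ {m t} (H : ColGraph m t) → Sub H → ℕ → Set
PathConstructible {m} H H₀ ℓ =
  Σ ℕ λ k → Σ (Fin k → PathData m) λ P →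
    (∀ j → IsPathIn H (P j)) ×
    (∀ j → ℓ ≤ plength (P j)) ×
    (∀ j j' → j ≢ j' → ∀ a b → EdgeOf (P j) a b → EdgeOf (P j') a b → ⊥) ×
    (∀ a b → (IsEdge H a b → T (eset H₀ a b) ⊎ Σ (Fin k) λ j → EdgeOf (P j) a b)
           × (T (eset H₀ a b) ⊎ Σ (Fin k) (λ j → EdgeOf (P j) a b) → IsEdge H a b)) ×
    (∀ j h → h ∈ inner (P j) → ¬ Before P j h) ×
    (∀ j → Before P j (start (P j)) ⊎ Before P j (end (P j)))
  where
    Before : ∀ {k} → (Fin k → PathData m) → Fin k → Fin m → Set
    Before {k} P j h = T (vset H₀ h) ⊎
      Σ (Fin k) λ j' → (toℕ j' < toℕ j) × (h ∈ pverts (P j'))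

-- c = ⌈ log s / log b ⌉  (for s ≥ 1, b ≥ 2): the least c with s ≤ b^c
IsCeilLog : ℕ → ℕ → ℕ → Set
IsCeilLog b s c = (s ≤ b ^ c) × (∀ j → s ≤ b ^ j → c ≤ j)

{-# OPTIONS --safe #-}

-- R(X,φ) is largest when every vertex is a root, so the roots can be forgotten: all that matters is
-- |Γ(X) ∖ im φ| ≥ Σ_X (D − deg).  Charging each new vertex to the pair (v,i) through which it is
-- attached gives a condition Σ_X w ≤ supply(X) with a fixed demand w and a supply that only grows when
-- vertices are freed, whether or not they have descendants: rolling back costs nothing.
-- A leaf can be added as in Friedman–Pippenger: sets attaining equality are smaller than s by joinedness
-- and closed under union by submodularity, so if every candidate leaf were blocked by such a set,
-- adding (v,i) to the union of these sets would violate the condition.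
-- A path has its missing endpoints embedded as isolated vertices, and then all but 2c inner vertices
-- leaf by leaf from the two ends.  Then (D−1)-ary trees of depth c grow from both sides, two of their
-- ≥ s leaves are joined by an edge of the missing colour, and everything off the branches to these two
-- leaves is freed.

module Submission where

open import Defs
open import Data.Bool using (Bool; true; false; T; _∧_; _∨_; not; if_then_else_)
open import Data.Bool.Properties using (T?)
open import Data.Empty using (⊥; ⊥-elim)
open import Data.Fin using (Fin; toℕ; fromℕ<) renaming (zero to fz; suc to fs)
open import Data.Fin.Properties using (_≟_; suc-injective; toℕ-injective; toℕ-fromℕ<; toℕ<n)
open import Data.Integer as ℤ using (ℤ)
import Data.Integer.Properties as ℤ
open import Data.List using (List; []; _∷_; _++_; length; allFin)
open import Data.List.Membership.DecPropositional using () renaming (_∈?_ to mem?)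
open import Data.List.Membership.Propositional using (_∈_; _∉_)
open import Data.List.Relation.Unary.All as All using (All; []; _∷_)
open import Data.List.Relation.Unary.All.Properties using (All¬⇒¬Any; ¬Any⇒All¬)
open import Data.List.Properties using (length-++)
open import Data.List.Membership.Propositional.Properties using (∈-++⁻; ∈-++⁺ˡ; ∈-++⁺ʳ; ∈-allFin)
open import Data.List.Relation.Unary.AllPairs using ([]; _∷_)
open import Data.List.Relation.Unary.Any using (here; there)
open import Data.List.Relation.Unary.Unique.Propositional using (Unique)
open import Data.Maybe using (Maybe; just; nothing; is-just)
open import Data.Maybe.Properties using (just-injective)
open import Data.Nat using (ℕ; zero; suc; _+_; _*_; _∸_; _^_; _≤_; _<_; z≤n; s≤s)
open import Data.Nat.Properties hiding (_≟_; suc-injective)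
open import Data.Nat.Tactic.RingSolver using (solve-∀)
open import Data.Product using (Σ; ∃; ∃₂; _×_; _,_; proj₁; proj₂)
open import Data.Sum using (_⊎_; inj₁; inj₂; [_,_]′)
open import Data.Unit using (⊤; tt)
open import Data.Vec.Functional using (updateAt)
open import Data.Vec.Functional.Properties using (updateAt-updates; updateAt-minimal)
open import Function using (_∘_; const; id)
open import Relation.Binary.PropositionalEquality as ≡ using (_≡_; _≢_; refl; cong; cong₂; subst; subst₂)
open import Relation.Nullary using (¬_; Dec; yes; no; contradiction)
open import Relation.Nullary.Decidable using (toWitness; fromWitness; ⌊_⌋; _×-dec_)

-- Booleans and indicator functions

-- An end of a path may have almost no demand left: the missing edge guarantees capacity for one
-- child in one colour, not for D - 1. Each tree is therefore rooted at an inner vertex that has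
-- just been embedded, where the demand is still D in every colour and there are no children. This
-- costs one inner vertex per side on top of the c found in the tree, so a path needs 2(c + 1) inner
-- vertices, that is, length 2c + 3. The colours along a path are prescribed, so every level of a
-- tree is grown in the single colour of the matching edge; demand and children are counted per pair
-- (v,i), and different colours at v do not compete. Goodness reaches up to 2s because critical sets
-- have fewer than s pairs: the union of two of them is still in range, where criticality brings its
-- size below s again. Unions of any number of critical sets can be taken this way.

T-∧ : ∀ {a b} → T a → T b → T (a ∧ b)
T-∧ {true} _ b = b

T-∧ˡ : ∀ {a b} → T (a ∧ b) → T a
T-∧ˡ {true} _ = tt

T-∧ʳ : ∀ {a b} → T (a ∧ b) → T b
T-∧ʳ {true} b = b

T-∨ˡ : ∀ {a b} → T a → T (a ∨ b)
T-∨ˡ {true} _ = tt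

T-∨ʳ : ∀ {a b} → T b → T (a ∨ b)
T-∨ʳ {true}  _ = tt
T-∨ʳ {false} b = b

T-∨-elim : ∀ {a b} → T (a ∨ b) → T a ⊎ T b
T-∨-elim {true}  _ = inj₁ tt
T-∨-elim {false} b = inj₂ b

T-not : ∀ {a} → ¬ T a → T (not a)
T-not {true}  ¬a = ⊥-elim (¬a tt)
T-not {false} _  = tt

T-not-elim : ∀ {a} → T (not a) → ¬ T a
T-not-elim {false} _ ()

T-== : ∀ {k} (a : Fin k) → T (a == a)
T-== a = fromWitness {a? = a ≟ a} refl

T-==-elim : ∀ {k} {a b : Fin k} → T (a == b) → a ≡ b
T-==-elim {a = a} {b} = toWitness {a? = a ≟ b}

T-is-just : ∀ {A : Set} {x : Maybe A} → T (is-just x) → ∃ λ a → x ≡ just a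
T-is-just {x = just a} _ = a , refl

just-T : ∀ {A : Set} {x : Maybe A} {a} → x ≡ just a → T (is-just x)
just-T refl = tt

just≢nothing : ∀ {A : Set} {x : Maybe A} {a} → x ≡ just a → x ≢ nothing
just≢nothing refl ()

isCol-intro : ∀ {k} {x : Maybe (Fin k)} {a} → x ≡ just a → T (isCol x a)
isCol-intro {a = a} refl = T-== a

isCol-elim : ∀ {k} {x : Maybe (Fin k)} {a} → T (isCol x a) → x ≡ just a
isCol-elim {x = just _} p = cong just (T-==-elim p)

ind-mono : ∀ {a b} → (T a → T b) → ind a ≤ ind b
ind-mono {false}         _ = z≤n
ind-mono {true}  {true}  _ = ≤-refl
ind-mono {true}  {false} f = ⊥-elim (f tt)

ind-disjoint : ∀ {a b c} → (T a → T c) → (T b → T c) → ¬ (T a × T b) → ind a + ind b ≤ ind c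
ind-disjoint {false}        _ g _ = ind-mono g
ind-disjoint {true} {false} f _ _ = ind-mono f
ind-disjoint {true} {true}  _ _ h = ⊥-elim (h (tt , tt))

ind-cover : ∀ {a b c} → (T a → T b ⊎ T c) → ind a ≤ ind b + ind c
ind-cover {false}                 _ = z≤n
ind-cover {true} {true}           _ = s≤s z≤n
ind-cover {true} {false} {true}   _ = ≤-refl
ind-cover {true} {false} {false}  f = [ ⊥-elim , ⊥-elim ]′ (f tt)

-- Submodularity at one vertex: a and b stand for being counted by the union and by the intersection
-- of two sets, c and d for being counted by the sets themselves.
ind-submodular : ∀ {a b c d} → (T a → T c ⊎ T d) → (T b → T c × T d) →
                 (T b → T a) → ind a + ind b ≤ ind c + ind d
ind-submodular {false} {false} _ _ _ = z≤n
ind-submodular {false} {true}  _ _ h = ⊥-elim (h tt)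
ind-submodular {true}  {false} f _ _ = ≤-trans (≤-reflexive (+-identityʳ 1)) (ind-cover f)
ind-submodular {true}  {true}  {true}  {true}  _ _ _ = ≤-refl
ind-submodular {true}  {true}  {false} {_}     _ g _ = ⊥-elim (proj₁ (g tt))
ind-submodular {true}  {true}  {true}  {false} _ g _ = ⊥-elim (proj₂ (g tt))

ind≡1 : ∀ {a} → T a → ind a ≡ 1
ind≡1 {true} _ = refl

anyFin-intro : ∀ {k} {p : Fin k → Bool} i → T (p i) → T (anyFin p)
anyFin-intro fz     pi = T-∨ˡ pi
anyFin-intro (fs i) pi = T-∨ʳ (anyFin-intro i pi)

anyFin-elim : ∀ {k} {p : Fin k → Bool} → T (anyFin p) → ∃ λ i → T (p i)
anyFin-elim {suc k} t with T-∨-elim t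
... | inj₁ p0 = fz , p0
... | inj₂ ps with anyFin-elim ps
...   | i , pi = fs i , pi

anyFin-cong : ∀ {k} {p p' : Fin k → Bool} → (∀ i → p i ≡ p' i) → anyFin p ≡ anyFin p'
anyFin-cong {zero}  _ = refl
anyFin-cong {suc k} e = cong₂ _∨_ (e fz) (anyFin-cong (e ∘ fs))

-- Sums over Fin

sumFin-cong : ∀ {k} {f g : Fin k → ℕ} → (∀ i → f i ≡ g i) → sumFin f ≡ sumFin g
sumFin-cong {zero}  _ = refl
sumFin-cong {suc k} e = cong₂ _+_ (e fz) (sumFin-cong (e ∘ fs))

sumFin-mono : ∀ {k} {f g : Fin k → ℕ} → (∀ i → f i ≤ g i) → sumFin f ≤ sumFin g
sumFin-mono {zero}  _ = z≤n
sumFin-mono {suc k} e = +-mono-≤ (e fz) (sumFin-mono (e ∘ fs))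

+-interchange : ∀ a b c d → (a + b) + (c + d) ≡ (a + c) + (b + d)
+-interchange = solve-∀

sumFin-+ : ∀ {k} (f g : Fin k → ℕ) → sumFin (λ i → f i + g i) ≡ sumFin f + sumFin g
sumFin-+ {zero}  f g = refl
sumFin-+ {suc k} f g = ≡.trans (cong (f fz + g fz +_) (sumFin-+ (f ∘ fs) (g ∘ fs)))
                               (+-interchange (f fz) (g fz) _ _)

sumFin-* : ∀ {k} (f : Fin k → ℕ) c → sumFin (λ i → f i * c) ≡ sumFin f * c
sumFin-* {zero}  f c = refl
sumFin-* {suc k} f c = ≡.trans (cong (f fz * c +_) (sumFin-* (f ∘ fs) c))
                               (≡.sym (*-distribʳ-+ c (f fz) _))

sumFin-zero : ∀ {k} {f : Fin k → ℕ} → (∀ i → f i ≡ 0) → sumFin f ≡ 0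
sumFin-zero {zero}  _ = refl
sumFin-zero {suc k} e = cong₂ _+_ (e fz) (sumFin-zero (e ∘ fs))

sumFin-one : ∀ k → sumFin {k} (λ _ → 1) ≡ k
sumFin-one zero    = refl
sumFin-one (suc k) = cong suc (sumFin-one k)

sumFin-swap : ∀ {k l} (f : Fin k → Fin l → ℕ) →
              sumFin (λ i → sumFin (f i)) ≡ sumFin (λ j → sumFin (λ i → f i j))
sumFin-swap {zero} {l} f = ≡.sym (sumFin-zero {l} (λ _ → refl))
sumFin-swap {suc k} {l} f = ≡.trans (cong (sumFin (f fz) +_) (sumFin-swap (f ∘ fs)))
                                (≡.sym (sumFin-+ {l} (f fz) _))

term≤sumFin : ∀ {k} {f : Fin k → ℕ} i → f i ≤ sumFin f
term≤sumFin fz     = m≤m+n _ _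
term≤sumFin (fs i) = m≤n⇒m≤o+n _ (term≤sumFin i)

sumFin-supported : ∀ {k} {f : Fin k → ℕ} i → (∀ j → j ≢ i → f j ≡ 0) → sumFin f ≡ f i
sumFin-supported {f = f} fz e =
  ≡.trans (cong (f fz +_) (sumFin-zero (λ j → e (fs j) λ ()))) (+-identityʳ _)
sumFin-supported (fs i) e =
  cong₂ _+_ (e fz λ ()) (sumFin-supported i (λ j j≢i → e (fs j) (j≢i ∘ suc-injective)))

count-mono : ∀ {k} {p p' : Fin k → Bool} → (∀ i → T (p i) → T (p' i)) → count p ≤ count p'
count-mono h = sumFin-mono (ind-mono ∘ h)

count-cover : ∀ {k} {p q r : Fin k → Bool} → (∀ i → T (p i) → T (q i) ⊎ T (r i)) →
              count p ≤ count q + count r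
count-cover {q = q} {r} h =
  ≤-trans (sumFin-mono (ind-cover ∘ h)) (≤-reflexive (sumFin-+ (ind ∘ q) (ind ∘ r)))

count-disjoint : ∀ {k} {p q r : Fin k → Bool} → (∀ i → T (p i) → T (r i)) →
                 (∀ i → T (q i) → T (r i)) → (∀ i → ¬ (T (p i) × T (q i))) →
                 count p + count q ≤ count r
count-disjoint {p = p} {q} f g h =
  ≤-trans (≤-reflexive (≡.sym (sumFin-+ (ind ∘ p) (ind ∘ q)))) (sumFin-mono λ i → ind-disjoint (f i) (g i) (h i))

count-single : ∀ {k} (i : Fin k) → count (i ==_) ≡ 1
count-single i =
  ≡.trans (sumFin-supported i off) (ind≡1 (T-== i))
  where
  off : ∀ j → j ≢ i → ind (i == j) ≡ 0
  off j j≢i with i ≟ j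
  ... | yes i≡j = contradiction (≡.sym i≡j) j≢i
  ... | no  _   = refl

count-all : ∀ k → count {k} (λ _ → true) ≡ k
count-all = sumFin-one

count-except : ∀ {k} {p p' : Fin k → Bool} x → (∀ y → y ≢ x → T (p y) → T (p' y)) →
               count p ≤ ind (p x) + count p'
count-except {suc k} {p} fz h =
  +-monoʳ-≤ (ind (p fz)) (m≤n⇒m≤o+n _ (count-mono (λ y → h (fs y) λ ())))
count-except {suc k} {p} {p'} (fs x) h = begin
  ind (p fz) + count (p ∘ fs)
    ≤⟨ +-mono-≤ (ind-mono (h fz λ ())) (count-except x (λ y y≢x → h (fs y) (y≢x ∘ suc-injective))) ⟩
  ind (p' fz) + (ind (p (fs x)) + count (p' ∘ fs))
    ≡⟨ rearrange (ind (p' fz)) (ind (p (fs x))) _ ⟩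
  ind (p (fs x)) + (ind (p' fz) + count (p' ∘ fs)) ∎
  where
  open ≤-Reasoning
  rearrange : ∀ a b c → a + (b + c) ≡ b + (a + c)
  rearrange = solve-∀

-- Double counting of the pairs (x,y) with f x = y: every counted y lies in at least one pair, every
-- x in at most one. Injectivity of f is not involved, and f may be a partial embedding.
count≤image : ∀ {k l} {p : Fin k → Bool} {r : Fin l → Bool} (f : Fin l → Maybe (Fin k)) →
              (∀ y → T (p y) → ∃ λ x → T (r x) × f x ≡ just y) → count p ≤ count r
count≤image {k} {l} {p} {r} f pre = begin
  count p
    ≤⟨ sumFin-mono (λ y → cover y) ⟩
  sumFin (λ y → count (λ x → r x ∧ isCol (f x) y))
    ≡⟨ sumFin-swap (λ y x → ind (r x ∧ isCol (f x) y)) ⟩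
  sumFin (λ x → count (λ y → r x ∧ isCol (f x) y))
    ≤⟨ sumFin-mono (λ x → fibre (r x) (f x)) ⟩
  count r ∎
  where
  open ≤-Reasoning
  cover : ∀ y → ind (p y) ≤ count (λ x → r x ∧ isCol (f x) y)
  cover y with p y | pre y
  ... | false | _ = z≤n
  ... | true  | h with h tt
  ...   | x , rx , fx≡y =
    ≤-trans (≤-reflexive (≡.sym (ind≡1 (T-∧ rx (isCol-intro fx≡y))))) (term≤sumFin x)
  fibre : ∀ b z → count (λ y → b ∧ isCol z y) ≤ ind b
  fibre false z        = ≤-reflexive (sumFin-zero {k} (λ _ → refl))
  fibre true  nothing  = ≤-trans (≤-reflexive (sumFin-zero {k} (λ _ → refl))) z≤n
  fibre true  (just v) = ≤-reflexive (count-single v)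

mem : ∀ {k} → List (Fin k) → Fin k → Bool
mem L x = ⌊ mem? _≟_ x L ⌋

mem-elim : ∀ {k} {L : List (Fin k)} {x} → T (mem L x) → x ∈ L
mem-elim {L = L} {x} = toWitness {a? = mem? _≟_ x L}

mem-intro : ∀ {k} {L : List (Fin k)} {x} → x ∈ L → T (mem L x)
mem-intro {L = L} {x} = fromWitness {a? = mem? _≟_ x L}

length≤count : ∀ {k} {L : List (Fin k)} → Unique L → length L ≤ count (mem L)
length≤count [] = z≤n
length≤count {L = x ∷ L} (x∉L ∷ uniq) = begin
  suc (length L)                ≤⟨ s≤s (length≤count uniq) ⟩
  suc (count (mem L))           ≡⟨ cong (_+ count (mem L)) (≡.sym (count-single x)) ⟩
  count (x ==_) + count (mem L) ≤⟨ count-disjoint at-x in-L (λ y → disjoint) ⟩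
  count (mem (x ∷ L))           ∎
  where
  open ≤-Reasoning
  at-x : ∀ y → T (x == y) → T (mem (x ∷ L) y)
  at-x y e = mem-intro {L = x ∷ L} (here (≡.sym (T-==-elim e)))
  in-L : ∀ y → T (mem L y) → T (mem (x ∷ L) y)
  in-L y e = mem-intro {L = x ∷ L} (there (mem-elim {L = L} e))
  disjoint : ∀ {y} → ¬ (T (x == y) × T (mem L y))
  disjoint (e , e') with T-==-elim e
  ... | refl = All¬⇒¬Any x∉L (mem-elim {L = L} e')

-- Partial functions on Fin

_⊑_ : ∀ {k} {B : Set} → (Fin k → Maybe B) → (Fin k → Maybe B) → Set
f ⊑ g = ∀ {x b} → f x ≡ just b → g x ≡ just b

⊑-nothing : ∀ {k} {B : Set} {f g : Fin k → Maybe B} → f ⊑ g → ∀ {x} → g x ≡ nothing → f x ≡ nothing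
⊑-nothing {f = f} f⊑g {x} gx with f x in fx
... | nothing = refl
... | just b  = contradiction gx (just≢nothing (f⊑g fx))

_[_≔_] : ∀ {k} {A : Set} → (Fin k → A) → Fin k → A → (Fin k → A)
f [ x ≔ a ] = updateAt f x (const a)

≔-same : ∀ {k} {A : Set} (f : Fin k → A) x {a} → (f [ x ≔ a ]) x ≡ a
≔-same f x = updateAt-updates x f

≔-other : ∀ {k} {A : Set} (f : Fin k → A) {x y} {a} → y ≢ x → (f [ x ≔ a ]) y ≡ f y
≔-other f {x} {y} = updateAt-minimal y x f

⊑-≔ : ∀ {k} {B : Set} (f : Fin k → Maybe B) {x b} → f x ≡ nothing → f ⊑ (f [ x ≔ just b ])
⊑-≔ f {x} fx {y} fy with y ≟ x
... | yes refl = contradiction fx (just≢nothing fy)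
... | no  y≢x  = ≡.trans (≔-other f y≢x) fy

≔-inv : ∀ {k} {B : Set} (f : Fin k → Maybe B) {x b y c} → (f [ x ≔ just b ]) y ≡ just c →
        (y ≡ x × b ≡ c) ⊎ f y ≡ just c
≔-inv f {x} {y = y} e with y ≟ x
... | yes refl = inj₁ (refl , just-injective (≡.trans (≡.sym (≔-same f x)) e))
... | no  y≢x  = inj₂ (≡.trans (≡.sym (≔-other f y≢x)) e)

nothing? : ∀ {A : Set} (x : Maybe A) → x ≡ nothing ⊎ ∃ λ a → x ≡ just a
nothing? nothing  = inj₁ refl
nothing? (just a) = inj₂ (a , refl)

-- Exhaustive search over finite function spaces, up to pointwise equality

-- Constructively, a failure of goodness has to yield a violating set, so all sets are searched. The
-- search meets a function only up to its values, hence the predicate must respect the given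
-- relation.
Searchable : (A : Set) → (A → A → Set) → Set₁
Searchable A _≈_ = (P : A → Set) → (∀ {x y} → x ≈ y → P x → P y) → (∀ x → Dec (P x)) →
                   ∃ P ⊎ (∀ x → ¬ P x)

searchBool : Searchable Bool _≡_
searchBool P _ P? with P? true | P? false
... | yes p | _     = inj₁ (true , p)
... | no _  | yes p = inj₁ (false , p)
... | no p  | no p' = inj₂ λ { true → p ; false → p' }

cons : ∀ {k} {A : Set} → A → (Fin k → A) → Fin (suc k) → A
cons a f fz     = a
cons a f (fs i) = f i

searchFun : ∀ k {A : Set} {_≈_ : A → A → Set} → (∀ {x} → x ≈ x) → Searchable A _≈_ →
            Searchable (Fin k → A) (λ f g → ∀ i → f i ≈ g i)
searchFun zero ≈-refl search P resp P? with P? (λ ())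
... | yes p = inj₁ (_ , p)
... | no ¬p = inj₂ λ f Pf → ¬p (resp (λ ()) Pf)
searchFun (suc k) {A} {_≈_} ≈-refl search P resp P? = conclude (search Q resp-Q Q?)
  where
  Q : A → Set
  Q a = ∃ λ f → P (cons a f)
  tail-search : ∀ a → Q a ⊎ (∀ f → ¬ P (cons a f))
  tail-search a = searchFun k ≈-refl search (P ∘ cons a)
    (λ e → resp λ { fz → ≈-refl ; (fs i) → e i }) (P? ∘ cons a)
  resp-Q : ∀ {a b} → a ≈ b → Q a → Q b
  resp-Q a≈b (f , p) = f , resp (λ { fz → a≈b ; (fs i) → ≈-refl }) p
  Q? : ∀ a → Dec (Q a)
  Q? a with tail-search a
  ... | inj₁ q = yes q
  ... | inj₂ n = no λ (f , p) → n f p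
  conclude : ∃ Q ⊎ (∀ a → ¬ Q a) → ∃ P ⊎ (∀ f → ¬ P f)
  conclude (inj₁ (a , f , p)) = inj₁ (cons a f , p)
  conclude (inj₂ n) = inj₂ λ f p →
    n (f fz) (f ∘ fs , resp (λ { fz → ≈-refl ; (fs i) → ≈-refl }) p)

Fin-choice : ∀ {k} {A B : Fin k → Set} → (∀ x → A x ⊎ B x) → ∃ A ⊎ (∀ x → B x)
Fin-choice {zero}  h = inj₂ λ ()
Fin-choice {suc k} h with h fz | Fin-choice (h ∘ fs)
... | inj₁ a | _            = inj₁ (fz , a)
... | inj₂ _ | inj₁ (x , a) = inj₁ (fs x , a)
... | inj₂ b | inj₂ bs      = inj₂ λ { fz → b ; (fs x) → bs x }

-- Sets of vertex-colour pairs

Pairs : ℕ → ℕ → Set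
Pairs n t = Fin n → Fin t → Bool

_∪_ _∩_ : ∀ {n t} → Pairs n t → Pairs n t → Pairs n t
(X ∪ Y) v i = X v i ∨ Y v i
(X ∩ Y) v i = X v i ∧ Y v i

∅ : ∀ {n t} → Pairs n t
∅ _ _ = false

⁅_,_⁆ : ∀ {n t} → Fin n → Fin t → Pairs n t
⁅ v , i ⁆ u j = (v == u) ∧ (i == j)

⋃ : ∀ {k n t} → (Fin k → Pairs n t) → Pairs n t
⋃ Xs v i = anyFin (λ y → Xs y v i)

sum2 : ∀ {n t} → (Fin n → Fin t → ℕ) → ℕ
sum2 f = sumFin (λ v → sumFin (f v))

sum2-cong : ∀ {n t} {f g : Fin n → Fin t → ℕ} → (∀ v i → f v i ≡ g v i) → sum2 f ≡ sum2 g
sum2-cong e = sumFin-cong λ v → sumFin-cong (e v)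

sum2-mono : ∀ {n t} {f g : Fin n → Fin t → ℕ} → (∀ v i → f v i ≤ g v i) → sum2 f ≤ sum2 g
sum2-mono e = sumFin-mono λ v → sumFin-mono (e v)

sum2-+ : ∀ {n t} (f g : Fin n → Fin t → ℕ) → sum2 (λ v i → f v i + g v i) ≡ sum2 f + sum2 g
sum2-+ f g = ≡.trans (sumFin-cong λ v → sumFin-+ (f v) (g v))
                     (sumFin-+ (λ v → sumFin (f v)) (λ v → sumFin (g v)))

sum2-* : ∀ {n t} (f : Fin n → Fin t → ℕ) c → sum2 (λ v i → f v i * c) ≡ sum2 f * c
sum2-* f c = ≡.trans (sumFin-cong λ v → sumFin-* (f v) c) (sumFin-* (λ v → sumFin (f v)) c)

sum2-zero : ∀ {n t} {f : Fin n → Fin t → ℕ} → (∀ v i → f v i ≡ 0) → sum2 f ≡ 0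
sum2-zero e = sumFin-zero λ v → sumFin-zero (e v)

term≤sum2 : ∀ {n t} {f : Fin n → Fin t → ℕ} v i → f v i ≤ sum2 f
term≤sum2 {f = f} v i = ≤-trans (term≤sumFin {f = f v} i) (term≤sumFin {f = λ u → sumFin (f u)} v)

restrict : ∀ {n t} → (Fin n → Fin t → ℕ) → Pairs n t → Fin n → Fin t → ℕ
restrict f X v i = if X v i then f v i else 0

wsum : ∀ {n t} → (Fin n → Fin t → ℕ) → Pairs n t → ℕ
wsum f X = sum2 (restrict f X)

if-mono : ∀ b {x y : ℕ} → x ≤ y → (if b then x else 0) ≤ (if b then y else 0)
if-mono true  x≤y = x≤y
if-mono false _   = z≤n

wsum-mono : ∀ {n t} {f g : Fin n → Fin t → ℕ} → (∀ v i → f v i ≤ g v i) →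
            ∀ X → wsum f X ≤ wsum g X
wsum-mono f≤g X = sum2-mono λ v i → if-mono (X v i) (f≤g v i)

wsum-+ : ∀ {n t} (f g : Fin n → Fin t → ℕ) X →
         wsum (λ v i → f v i + g v i) X ≡ wsum f X + wsum g X
wsum-+ f g X = ≡.trans (sum2-cong λ v i → split (X v i) (f v i) (g v i))
  (sum2-+ (restrict f X) (restrict g X))
  where
  split : ∀ b x y → (if b then x + y else 0) ≡ (if b then x else 0) + (if b then y else 0)
  split true  x y = refl
  split false x y = refl

wsum-modular : ∀ {n t} (f : Fin n → Fin t → ℕ) X Y →
               wsum f (X ∪ Y) + wsum f (X ∩ Y) ≡ wsum f X + wsum f Y
wsum-modular f X Y = ≡.trans (≡.sym (sum2-+ (restrict f (X ∪ Y)) (restrict f (X ∩ Y))))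
  (≡.trans (sum2-cong λ v i → modular (X v i) (Y v i) (f v i))
           (sum2-+ (restrict f X) (restrict f Y)))
  where
  modular : ∀ a b x → (if a ∨ b then x else 0) + (if a ∧ b then x else 0)
                    ≡ (if a then x else 0) + (if b then x else 0)
  modular true  true  x = refl
  modular true  false x = refl
  modular false true  x = +-identityʳ x
  modular false false x = refl

wsum-insert : ∀ {n t} (f : Fin n → Fin t → ℕ) X v i → ¬ T (X v i) →
              wsum f X + f v i ≤ wsum f (X ∪ ⁅ v , i ⁆)
wsum-insert f X v i Xvi = begin
  wsum f X + f v i
    ≤⟨ +-monoʳ-≤ (wsum f X) single ⟩
  wsum f X + wsum f ⁅ v , i ⁆
    ≡⟨ ≡.sym (wsum-modular f X ⁅ v , i ⁆) ⟩
  wsum f (X ∪ ⁅ v , i ⁆) + wsum f (X ∩ ⁅ v , i ⁆)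
    ≡⟨ cong (wsum f (X ∪ ⁅ v , i ⁆) +_) (sum2-zero disjoint) ⟩
  wsum f (X ∪ ⁅ v , i ⁆) + 0
    ≡⟨ +-identityʳ _ ⟩
  wsum f (X ∪ ⁅ v , i ⁆) ∎
  where
  open ≤-Reasoning
  when : ∀ b {x : ℕ} → T b → x ≡ (if b then x else 0)
  when true _ = refl
  unless : ∀ b {x : ℕ} → ¬ T b → (if b then x else 0) ≡ 0
  unless true  ¬b = ⊥-elim (¬b tt)
  unless false _  = refl
  single : f v i ≤ wsum f ⁅ v , i ⁆
  single = ≤-trans (≤-reflexive (when (⁅ v , i ⁆ v i) (T-∧ (T-== v) (T-== i)))) (term≤sum2 v i)
  disjoint : ∀ u j → (if (X ∩ ⁅ v , i ⁆) u j then f u j else 0) ≡ 0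
  disjoint u j = unless _ λ both → Xvi (subst₂ (λ u j → T (X u j))
    (≡.sym (T-==-elim (T-∧ˡ (T-∧ʳ {X u j} both))))
    (≡.sym (T-==-elim (T-∧ʳ {v == u} (T-∧ʳ {X u j} both)))) (T-∧ˡ both))

count2-mono : ∀ {n t} {X Y : Pairs n t} → (∀ v i → T (X v i) → T (Y v i)) → count2 X ≤ count2 Y
count2-mono h = sum2-mono λ v i → ind-mono (h v i)

count2-∪ : ∀ {n t} (X Y : Pairs n t) → count2 (X ∪ Y) ≤ count2 X + count2 Y
count2-∪ X Y =
  ≤-trans (sum2-mono λ v i → ind-cover {X v i ∨ Y v i} (T-∨-elim {X v i}))
          (≤-reflexive (sum2-+ (λ v i → ind (X v i)) (λ v i → ind (Y v i))))

count2-single : ∀ {n t} (v : Fin n) (i : Fin t) → count2 ⁅ v , i ⁆ ≤ 1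
count2-single {t = t} v i = ≤-reflexive (≡.trans (sumFin-supported v off) (≡.trans on (count-single i)))
  where
  off : ∀ u → u ≢ v → count (⁅ v , i ⁆ u) ≡ 0
  off u u≢v with v ≟ u
  ... | yes v≡u = contradiction (≡.sym v≡u) u≢v
  ... | no  _   = sumFin-zero {t} λ _ → refl
  on : count (⁅ v , i ⁆ v) ≡ count (i ==_)
  on with v ≟ v
  ... | yes _   = refl
  ... | no v≢v  = contradiction refl v≢v

wsum≤ : ∀ {n t} (f : Fin n → Fin t → ℕ) D → (∀ v i → f v i ≤ D) → ∀ X → wsum f X ≤ count2 X * D
wsum≤ f D f≤D X = ≤-trans (sum2-mono λ v i → bound (X v i) (f≤D v i))
                          (≤-reflexive (sum2-* (λ v i → ind (X v i)) D))
  where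
  bound : ∀ b {x} → x ≤ D → (if b then x else 0) ≤ ind b * D
  bound true  x≤D = ≤-trans x≤D (≤-reflexive (≡.sym (*-identityˡ D)))
  bound false _   = z≤n

searchPairs : ∀ n t → Searchable (Pairs n t) (λ X Y → ∀ v i → X v i ≡ Y v i)
searchPairs n t = searchFun n (λ _ → refl) (searchFun t refl searchBool)

Γ-intro : ∀ {n t} {G : GraphFamily n t} {X : Pairs n t} {v i y} →
          T (X v i) → T (adj G i v y) → T (Γ G X y)
Γ-intro {v = v} {i} Xvi e = anyFin-intro v (anyFin-intro i (T-∧ Xvi e))

Γ-elim : ∀ {n t} {G : GraphFamily n t} {X : Pairs n t} {y} →
         T (Γ G X y) → ∃₂ λ v i → T (X v i) × T (adj G i v y)
Γ-elim {X = X} g with anyFin-elim g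
... | v , g' with anyFin-elim g'
...   | i , p = v , i , T-∧ˡ p , T-∧ʳ {X v i} p

Γ-mono : ∀ {n t} {G : GraphFamily n t} {X Y : Pairs n t} {y} →
         (∀ v i → T (X v i) → T (Y v i)) → T (Γ G X y) → T (Γ G Y y)
Γ-mono {G = G} {X} X⊆Y g with Γ-elim {G = G} {X} g
... | v , i , Xvi , e = Γ-intro {G = G} (X⊆Y v i Xvi) e

Γ-∪ : ∀ {n t} {G : GraphFamily n t} (X Y : Pairs n t) {y} →
      T (Γ G (X ∪ Y) y) → T (Γ G X y) ⊎ T (Γ G Y y)
Γ-∪ {G = G} X Y g with Γ-elim {G = G} {X ∪ Y} g
... | v , i , XYvi , e with T-∨-elim {X v i} XYvi
...   | inj₁ Xvi = inj₁ (Γ-intro {G = G} Xvi e)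
...   | inj₂ Yvi = inj₂ (Γ-intro {G = G} Yvi e)

-- Labellings

-- `nothing` marks a free vertex, `seed` a vertex embedded without using an edge,
-- and `child v i` a vertex attached to v by an edge of colour i.
data Label (n t : ℕ) : Set where
  seed  : Label n t
  child : Fin n → Fin t → Label n t

Labelling : ℕ → ℕ → Set
Labelling n t = Fin n → Maybe (Label n t)

isChild : ∀ {n t} → Fin n → Fin t → Maybe (Label n t) → Bool
isChild v i (just (child u j)) = (u == v) ∧ (j == i)
isChild v i _                  = false

isChild-elim : ∀ {n t} {v : Fin n} {i : Fin t} {l} → T (isChild v i l) → l ≡ just (child v i)
isChild-elim {v = v} {l = just (child u j)} c =
  cong₂ (λ u j → just (child u j)) (T-==-elim (T-∧ˡ c)) (T-==-elim (T-∧ʳ {u == v} c))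

isChild-self : ∀ {n t} (v : Fin n) (i : Fin t) → T (isChild v i (just (child v i)))
isChild-self v i = T-∧ (T-== v) (T-== i)

used : ∀ {n t} → Labelling n t → ℕ
used q = count (λ y → is-just (q y))

children : ∀ {n t} → Labelling n t → Fin n → Fin t → ℕ
children q v i = count (λ y → isChild v i (q y))

count-≔ : ∀ {k} {A : Set} (p : A → Bool) (f : Fin k → A) x a →
          count (λ y → p ((f [ x ≔ a ]) y)) ≤ ind (p a) + count (λ y → p (f y))
count-≔ p f x a = subst (λ b → count (λ y → p ((f [ x ≔ a ]) y)) ≤ ind (p b) + count (λ y → p (f y)))
  (≔-same f x) (count-except x λ y y≢x → subst (T ∘ p) (≔-other f y≢x))

used-≔ : ∀ {n t} (q : Labelling n t) x l → used (q [ x ≔ just l ]) ≤ suc (used q)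
used-≔ q x l = count-≔ is-just q x (just l)

children-≔ : ∀ {n t} (q : Labelling n t) x u j v →
             children (q [ x ≔ just (child u j) ]) v j ≤ ind (u == v) + children q v j
children-≔ q x u j v = ≤-trans (count-≔ (isChild v j) q x (just (child u j)))
  (+-monoˡ-≤ (children q v j) (ind-mono {(u == v) ∧ (j == j)} T-∧ˡ))

no-children : ∀ {n t} (q : Labelling n t) {v i} → (∀ y → q y ≢ just (child v i)) → children q v i ≡ 0
no-children q {v} {i} none = sumFin-zero λ y → zero-ind λ c → none y (isChild-elim c)
  where
  zero-ind : ∀ {b} → ¬ T b → ind b ≡ 0
  zero-ind {true}  ¬b = ⊥-elim (¬b tt)
  zero-ind {false} _  = refl

-- Replacing an attached vertex's contribution [y ∈ Γ(X)] by [(v,i) ∈ X] turns the condition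
-- R(X,φ) ≥ 0 into demand ≤ supply, where the demand does not depend on the embedding.
avail : ∀ {n t} → GraphFamily n t → Pairs n t → Fin n → Maybe (Label n t) → Bool
avail G X y nothing            = Γ G X y
avail G X y (just seed)        = false
avail G X y (just (child v i)) = X v i

avail-cong : ∀ {n t} (G : GraphFamily n t) {X Y : Pairs n t} → (∀ v i → X v i ≡ Y v i) →
             ∀ y l → avail G X y l ≡ avail G Y y l
avail-cong G e y nothing =
  anyFin-cong λ v → anyFin-cong λ i → cong (_∧ adj G i v y) (e v i)
avail-cong G e y (just seed)        = refl
avail-cong G e y (just (child v i)) = e v i

avail-submodular : ∀ {n t} (G : GraphFamily n t) (X Y : Pairs n t) y l →
                   ind (avail G (X ∪ Y) y l) + ind (avail G (X ∩ Y) y l)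
                   ≤ ind (avail G X y l) + ind (avail G Y y l)
avail-submodular G X Y y nothing = ind-submodular {Γ G (X ∪ Y) y} (Γ-∪ {G = G} X Y)
  (λ g → Γ-mono {G = G} (λ v i → T-∧ˡ) g , Γ-mono {G = G} (λ v i → T-∧ʳ {X v i}) g)
  (Γ-mono {G = G} {X ∩ Y} (λ v i → T-∨ˡ {X v i} ∘ T-∧ˡ))
avail-submodular G X Y y (just seed) = z≤n
avail-submodular G X Y y (just (child v i)) = ind-submodular {X v i ∨ Y v i} (T-∨-elim {X v i})
  (λ p → T-∧ˡ p , T-∧ʳ {X v i} p) (T-∨ˡ {X v i} ∘ T-∧ˡ)

supply : ∀ {n t} → GraphFamily n t → Labelling n t → Pairs n t → ℕ
supply G q X = count (λ y → avail G X y (q y))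

supply-submodular : ∀ {n t} (G : GraphFamily n t) q (X Y : Pairs n t) →
                    supply G q (X ∪ Y) + supply G q (X ∩ Y) ≤ supply G q X + supply G q Y
supply-submodular G q X Y = subst₂ _≤_ (sumFin-+ (at (X ∪ Y)) (at (X ∩ Y))) (sumFin-+ (at X) (at Y))
  (sumFin-mono λ y → avail-submodular G X Y y (q y))
  where
  at : Pairs _ _ → Fin _ → ℕ
  at Z y = ind (avail G Z y (q y))

-- `attached` is what puts a freed child back into Γ(X). `closed` implies that a free vertex has no
-- children, so a newly embedded vertex starts without any.
record Sound {n t} (G : GraphFamily n t) (q : Labelling n t) : Set where
  field
    attached : ∀ {y v i} → q y ≡ just (child v i) → T (adj G i v y)
    closed   : ∀ {y v i} → q y ≡ just (child v i) → ∃ λ l → q v ≡ just l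
open Sound

avail-free : ∀ {n t} {G : GraphFamily n t} {q} → Sound G q →
             ∀ {X y l} → q y ≡ just l → T (avail G X y (just l)) → T (Γ G X y)
avail-free {G = G} sound {l = child v i} qy Xvi = Γ-intro {G = G} Xvi (attached sound qy)

-- The comparison is made at each y separately: a child of (v,i) in X is adjacent to v in colour i,
-- so once freed it is counted as a member of Γ(X). The labels of its descendants do not enter.
supply-antitone : ∀ {n t} {G : GraphFamily n t} {q q' : Labelling n t} → Sound G q' → q ⊑ q' →
                  ∀ X → supply G q' X ≤ supply G q X
supply-antitone {G = G} {q} {q'} sound q⊑q' X = count-mono λ y → compare y (q y) refl
  where
  compare : ∀ y l → q y ≡ l → T (avail G X y (q' y)) → T (avail G X y l)
  compare y (just l) qy a = subst (T ∘ avail G X y) (q⊑q' qy) a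
  compare y nothing  qy a with q' y in q'y
  ... | nothing = a
  ... | just l  = avail-free sound q'y a

-- Growing trees

Sound-≔ : ∀ {n t} {G : GraphFamily n t} {q : Labelling n t} {x v i l} → Sound G q → q x ≡ nothing →
          q v ≡ just l → T (adj G i v x) → Sound G (q [ x ≔ just (child v i) ])
Sound-≔ {G = G} {q} {x} {v} {i} {l} sound qx qv e = record { attached = attached' ; closed = closed' }
  where
  q' : Labelling _ _
  q' = q [ x ≔ just (child v i) ]
  attached' : ∀ {y u j} → q' y ≡ just (child u j) → T (adj G j u y)
  attached' q'y with ≔-inv q q'y
  ... | inj₁ (refl , refl) = e
  ... | inj₂ qy            = attached sound qy
  closed' : ∀ {y u j} → q' y ≡ just (child u j) → ∃ λ l → q' u ≡ just l
  closed' q'y with ≔-inv q q'y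
  ... | inj₁ (refl , refl) = l , ⊑-≔ q qx qv
  ... | inj₂ qy with closed sound qy
  ...   | l' , qu = l' , ⊑-≔ q qx qu

mult : ∀ {k} → Fin k → List (Fin k) → ℕ
mult v []      = 0
mult v (u ∷ W) = ind (u == v) + mult v W

mult-++ : ∀ {k} (v : Fin k) L W → mult v (L ++ W) ≡ mult v L + mult v W
mult-++ v []      W = refl
mult-++ v (u ∷ L) W = ≡.trans (cong (ind (u == v) +_) (mult-++ v L W)) (≡.sym (+-assoc (ind (u == v)) _ _))

mult-absent : ∀ {k} {v : Fin k} {L} → All (v ≢_) L → mult v L ≡ 0
mult-absent [] = refl
mult-absent {v = v} {u ∷ L} (v≢u ∷ rest) with u ≟ v
... | yes u≡v = contradiction (≡.sym u≡v) v≢u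
... | no  _   = mult-absent rest

mult-unique : ∀ {k} (v : Fin k) {L} → Unique L → mult v L ≤ 1
mult-unique v [] = z≤n
mult-unique v {u ∷ L} (u∉L ∷ uniq) with u ≟ v
... | yes refl = ≤-reflexive (cong suc (mult-absent u∉L))
... | no  _    = mult-unique v uniq

-- A level of a tree is requested as a list in which every current leaf occurs b times, one
-- occurrence for each child it is to receive.
copies : ∀ {A : Set} → ℕ → List A → List A
copies zero    L = []
copies (suc b) L = L ++ copies b L

copies-mult : ∀ {k} b (v : Fin k) {L} → Unique L → mult v (copies b L) ≤ b
copies-mult zero    v uniq = z≤n
copies-mult (suc b) v {L} uniq = ≤-trans (≤-reflexive (mult-++ v L _))
  (+-mono-≤ (mult-unique v uniq) (copies-mult b v uniq))

copies-length : ∀ {A : Set} b (L : List A) → length (copies b L) ≡ b * length L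
copies-length zero    L = refl
copies-length (suc b) L = ≡.trans (length-++ L) (cong (length L +_) (copies-length b L))

copies-∈ : ∀ {A : Set} {x : A} b {L} → x ∈ copies b L → x ∈ L
copies-∈ (suc b) {L} x∈ with ∈-++⁻ L x∈
... | inj₁ x∈L = x∈L
... | inj₂ x∈' = copies-∈ b x∈'

-- The sum b + b^2 + ... + b^k; the root is left out because it is already in use.
treeSize : ℕ → ℕ → ℕ
treeSize b zero    = 0
treeSize b (suc k) = treeSize b k + b ^ suc k

-- The earlier levels together are at most 2b^k, which is at most b^(k+1) as b ≥ 2. This is where D
-- ≥ 3 enters.
treeSize≤ : ∀ {b} → 2 ≤ b → ∀ k → treeSize b k ≤ 2 * b ^ k
treeSize≤ 2≤b zero = z≤n
treeSize≤ {b} 2≤b (suc k) = ≤-trans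
  (+-mono-≤ (≤-trans (treeSize≤ 2≤b k) (*-monoˡ-≤ (b ^ k) 2≤b)) ≤-refl)
  (≤-reflexive (cong (b ^ suc k +_) (≡.sym (+-identityʳ _))))

-- The vertices below the root v and the colours of the edges, both listed from the leaf.
data Branch {n t} (q : Labelling n t) (v : Fin n) : List (Fin t) → List (Fin n) → Fin n → Set where
  []   : Branch q v [] [] v
  grow : ∀ {is xs u i x} → Branch q v is xs u → q x ≡ just (child u i) → x ∉ xs →
         Branch q v (i ∷ is) (x ∷ xs) x

Branch-⊑ : ∀ {n t} {q q' : Labelling n t} {v is xs u} → q ⊑ q' → Branch q v is xs u → Branch q' v is xs u
Branch-⊑ q⊑q' []               = []
Branch-⊑ q⊑q' (grow br qx x∉) = grow (Branch-⊑ q⊑q' br) (q⊑q' qx) x∉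

Branch-used : ∀ {n t} {q : Labelling n t} {v is xs u x} → Branch q v is xs u → x ∈ xs → ∃ λ l → q x ≡ just l
Branch-used (grow br qx _) (here refl) = _ , qx
Branch-used (grow br _ _)  (there x∈)  = Branch-used br x∈

Branch-leaf : ∀ {n t} {q : Labelling n t} {v is xs u} → Branch q v is xs u → u ≡ v ⊎ u ∈ xs
Branch-leaf []           = inj₁ refl
Branch-leaf (grow _ _ _) = inj₂ (here refl)

-- Good labellings and critical sets

module Goodness {n t : ℕ} (G : GraphFamily n t) (s D : ℕ) (1≤s : 1 ≤ s)
                (joined : SJoined s G) (w : Fin n → Fin t → ℕ) (w≤D : ∀ v i → w v i ≤ D) where

  GoodL : Labelling n t → Set
  GoodL q = ∀ X → count2 X ≤ 2 * s → wsum w X ≤ supply G q X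

  GoodL-⊑ : ∀ {q q'} → Sound G q' → q ⊑ q' → GoodL q' → GoodL q
  GoodL-⊑ sound q⊑q' good X small = ≤-trans (good X small) (supply-antitone sound q⊑q' X)

  -- 2sD bounds the demand of a set of at most 2s pairs, hence the supply of a critical set; the
  -- additional s pays for the vertices outside Γ(X) that joinedness permits.
  slack : ℕ
  slack = 2 * s * D + s

  -- For a good labelling the inequality is an equality: such a set can afford no loss of supply.
  Critical : Labelling n t → Pairs n t → Set
  Critical q X = count2 X ≤ 2 * s × supply G q X ≤ wsum w X

  few-outside : ∀ X → s ≤ count2 X → count (λ y → not (Γ G X y)) < s
  few-outside X large with s ≤? count (λ y → not (Γ G X y))
  ... | no  s≰ = ≰⇒> s≰
  ... | yes s≤ with joined X (λ y → not (Γ G X y)) large s≤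
  ...   | u , i , v , Xui , v∉Γ , e = contradiction (Γ-intro {G = G} Xui e) (T-not-elim v∉Γ)

  -- Every vertex lies outside Γ(X), is in use, or is counted by the supply. If X had s pairs, these
  -- classes would have fewer than s, `used q` and at most 2sD members, too few for n.
  critical-small : ∀ {q X} → used q + slack ≤ n → Critical q X → count2 X < s
  critical-small {q} {X} room (small , crit) with s ≤? count2 X
  ... | no  s≰   = ≰⇒> s≰
  ... | yes large = contradiction room (<⇒≱ (begin-strict
    n
      ≡⟨ ≡.sym (count-all n) ⟩
    count (λ (_ : Fin n) → true)
      ≤⟨ count-cover {q = λ y → not (Γ G X y)} {λ y → is-just (q y) ∨ avail G X y (q y)} (λ y _ → cover y (q y)) ⟩
    count (λ y → not (Γ G X y)) + count (λ y → is-just (q y) ∨ avail G X y (q y))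
      <⟨ +-mono-<-≤ (few-outside X large)
           (count-cover {p = λ y → is-just (q y) ∨ avail G X y (q y)} λ y → T-∨-elim {is-just (q y)}) ⟩
    s + (used q + supply G q X)
      ≤⟨ +-monoʳ-≤ s (+-monoʳ-≤ (used q) (≤-trans crit
           (≤-trans (wsum≤ w D w≤D X) (*-monoˡ-≤ D small)))) ⟩
    s + (used q + 2 * s * D)
      ≡⟨ ≡.trans (+-comm s _) (+-assoc (used q) _ s) ⟩
    used q + slack ∎))
    where
    open ≤-Reasoning
    cover : ∀ y l → T (not (Γ G X y)) ⊎ T (is-just l ∨ avail G X y l)
    cover y (just l) = inj₂ tt
    cover y nothing with Γ G X y
    ... | true  = inj₂ tt
    ... | false = inj₁ tt

  ∅-critical : ∀ q → Critical q ∅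
  ∅-critical q = ≤-trans (≤-reflexive (sum2-zero {n} {t} λ _ _ → refl)) z≤n ,
                 ≤-trans (count-mono {p' = λ _ → false} λ y → none y (q y))
                         (≤-trans (≤-reflexive (sumFin-zero {n} λ _ → refl)) z≤n)
    where
    none : ∀ y l → T (avail G ∅ y l) → ⊥
    none y nothing g with Γ-elim {G = G} {∅ {n} {t}} {y} g
    ... | _ , _ , () , _
    none y (just seed)        ()
    none y (just (child _ _)) ()

  -- Uncrossing: supply is submodular, demand is modular, and goodness bounds the supply of the
  -- intersection from below, so no surplus is left for the union.
  ∪-critical : ∀ {q X Y} → GoodL q → used q + slack ≤ n →
               Critical q X → Critical q Y → Critical q (X ∪ Y)
  ∪-critical {q} {X} {Y} good room cX cY = small , +-cancelʳ-≤ (wsum w (X ∩ Y)) _ _ (begin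
    supply G q (X ∪ Y) + wsum w (X ∩ Y)
      ≤⟨ +-monoʳ-≤ (supply G q (X ∪ Y)) (good (X ∩ Y)
           (≤-trans (count2-mono λ v i → T-∧ˡ {X v i}) (proj₁ cX))) ⟩
    supply G q (X ∪ Y) + supply G q (X ∩ Y)
      ≤⟨ supply-submodular G q X Y ⟩
    supply G q X + supply G q Y
      ≤⟨ +-mono-≤ (proj₂ cX) (proj₂ cY) ⟩
    wsum w X + wsum w Y
      ≡⟨ ≡.sym (wsum-modular w X Y) ⟩
    wsum w (X ∪ Y) + wsum w (X ∩ Y) ∎)
    where
    open ≤-Reasoning
    small : count2 (X ∪ Y) ≤ 2 * s
    small = ≤-trans (count2-∪ X Y) (+-mono-≤ (<⇒≤ (critical-small room cX))
      (≤-trans (<⇒≤ (critical-small room cY)) (≤-reflexive (≡.sym (+-identityʳ s)))))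

  ⋃-critical : ∀ {q k} (Xs : Fin k → Pairs n t) → GoodL q → used q + slack ≤ n →
               (∀ y → Critical q (Xs y)) → Critical q (⋃ Xs)
  ⋃-critical {q} {zero}  Xs good room c = ∅-critical q
  ⋃-critical {q} {suc k} Xs good room c =
    ∪-critical good room (c fz) (⋃-critical (Xs ∘ fs) good room (c ∘ fs))

  -- Labelling x changes the supply only at x, by at most one. A set violated afterwards was
  -- therefore tight before, and it must have lost exactly x: x was in Γ(X) and its new label is not
  -- counted by X.
  good-or-critical : ∀ {q x} l → GoodL q → q x ≡ nothing →
    GoodL (q [ x ≔ just l ]) ⊎
    ∃ λ X → Critical q X × T (Γ G X x) × ¬ T (avail G X x (just l))
  good-or-critical {q} {x} l good qx = conclude (searchPairs n t Violated respect violated?)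
    where
    q' : Labelling n t
    q' = q [ x ≔ just l ]
    Violated : Pairs n t → Set
    Violated X = count2 X ≤ 2 * s × supply G q' X < wsum w X
    respect : ∀ {X Y} → (∀ v i → X v i ≡ Y v i) → Violated X → Violated Y
    respect e (small , v) =
      subst (_≤ 2 * s) (sum2-cong λ v i → cong ind (e v i)) small ,
      subst₂ _<_ (sumFin-cong λ y → cong ind (avail-cong G e y (q' y)))
                 (sum2-cong λ v i → cong (λ b → if b then w v i else 0) (e v i)) v
    violated? : ∀ X → Dec (Violated X)
    violated? X = (count2 X ≤? 2 * s) ×-dec (supply G q' X <? wsum w X)
    elsewhere : ∀ X y → y ≢ x → T (avail G X y (q y)) → T (avail G X y (q' y))
    elsewhere X y y≢x = subst (T ∘ avail G X y) (≡.sym (≔-other q y≢x))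
    crit : ∀ {X} → Violated X → Critical q X
    crit {X} (small , v) = small , ≤-trans
      (count-except {p = λ y → avail G X y (q y)} x (elsewhere X))
      (≤-trans (+-monoˡ-≤ (supply G q' X) (ind-mono {b = true} (const tt))) v)
    not-free : ∀ {X} → Violated X → ¬ (T (Γ G X x) → T (avail G X x (just l)))
    not-free {X} (small , v) h = <⇒≱ v (≤-trans (good X small) (count-mono compare))
      where
      compare : ∀ y → T (avail G X y (q y)) → T (avail G X y (q' y))
      compare y a with y ≟ x
      ... | no y≢x   = elsewhere X y y≢x a
      ... | yes refl = subst (T ∘ avail G X x) (≡.sym (≔-same q x))
                         (h (subst (T ∘ avail G X x) qx a))
    blocking : ∀ X → ¬ (T (Γ G X x) → T (avail G X x (just l))) →
               T (Γ G X x) × ¬ T (avail G X x (just l))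
    blocking X h with T? (Γ G X x) | T? (avail G X x (just l))
    ... | yes g | no ¬a = g , ¬a
    ... | _     | yes a = contradiction (const a) h
    ... | no ¬g | _     = contradiction (⊥-elim ∘ ¬g) h
    conclude : ∃ Violated ⊎ (∀ X → ¬ Violated X) → _
    conclude (inj₁ (X , v)) = inj₂ (X , crit v , blocking X (not-free v))
    conclude (inj₂ none)    = inj₁ λ X small → ≮⇒≥ λ v → none X (small , v)

  -- If no candidate could be labelled l, the union of the sets blocking the candidates would be critical.
  label-or-cover : ∀ {q} l → (Candidate : Fin n → Bool) → GoodL q → used q + slack ≤ n →
    (∃ λ x → q x ≡ nothing × T (Candidate x) × GoodL (q [ x ≔ just l ])) ⊎
    (∃ λ X → Critical q X × (∀ x → q x ≡ nothing → T (Candidate x) → T (Γ G X x)) ×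
             (∀ v i → l ≡ child v i → ¬ T (X v i)))
  label-or-cover {q} l Candidate good room = conclude (Fin-choice dichotomy)
    where
    Success : Fin n → Set
    Success x = q x ≡ nothing × T (Candidate x) × GoodL (q [ x ≔ just l ])
    Blocked : Fin n → Set
    Blocked x = ∃ λ X → Critical q X × (q x ≡ nothing → T (Candidate x) → T (Γ G X x)) ×
                        (∀ v i → l ≡ child v i → ¬ T (X v i))
    dichotomy : ∀ x → Success x ⊎ Blocked x
    dichotomy x with nothing? (q x) | T? (Candidate x)
    -- A vertex in use, or one that is no candidate, has nothing to cover; the empty set is a
    -- critical placeholder that does not affect the union.
    ... | inj₂ (_ , qx) | _      = inj₂ (∅ , ∅-critical q , (λ qx' → contradiction qx' (just≢nothing qx)) , λ _ _ _ ())
    ... | inj₁ _        | no ¬c  = inj₂ (∅ , ∅-critical q , (λ _ c → contradiction c ¬c) , λ _ _ _ ())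
    ... | inj₁ qx       | yes c with good-or-critical l good qx
    ...   | inj₁ good'              = inj₁ (qx , c , good')
    ...   | inj₂ (X , crit , g , ¬a) = inj₂ (X , crit , (λ _ _ → g) , λ { v i refl → ¬a })
    conclude : ∃ Success ⊎ (∀ x → Blocked x) → _
    conclude (inj₁ success) = inj₁ success
    conclude (inj₂ blocked) = inj₂
      ( ⋃ (proj₁ ∘ blocked)
      , ⋃-critical _ good room (λ x → proj₁ (proj₂ (blocked x)))
      , (λ x qx c → Γ-mono {G = G} (λ v i → anyFin-intro x) (proj₁ (proj₂ (proj₂ (blocked x))) qx c))
      , λ v i l≡ X*vi → let (x , Xvi) = anyFin-elim X*vi
                        in proj₂ (proj₂ (proj₂ (blocked x))) v i l≡ Xvi )

  -- Otherwise inserting (v,i) into the blocking set X raises the demand by w v i and the supply by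
  -- at most the present number of children of (v,i), which is smaller; as X was tight, goodness
  -- fails at the enlarged set.
  add-child : ∀ {q v i} → GoodL q → used q + slack ≤ n → children q v i < w v i →
    ∃ λ x → q x ≡ nothing × T (adj G i v x) × GoodL (q [ x ≔ just (child v i) ])
  add-child {q} {v} {i} good room capacity
    with label-or-cover (child v i) (adj G i v) good room
  ... | inj₁ found = found
  ... | inj₂ (X , crit , covers , absent) = contradiction capacity (≤⇒≯ overloaded)
    where
    open ≤-Reasoning
    X+ : Pairs n t
    X+ = X ∪ ⁅ v , i ⁆
    small : count2 X+ ≤ 2 * s
    small = ≤-trans (count2-∪ X ⁅ v , i ⁆) (≤-trans (+-monoʳ-≤ (count2 X) (count2-single v i))
      (≤-trans (≤-reflexive (+-comm _ 1)) (≤-trans (critical-small room crit) (m≤m+n s _))))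
    -- A free neighbour of v in colour i is a candidate, hence already in Γ(X); only children of
    -- (v,i) can be newly counted.
    gain : ∀ y l → q y ≡ l → T (avail G X+ y l) → T (avail G X y l) ⊎ T (isChild v i l)
    gain y nothing qy a with Γ-∪ {G = G} X ⁅ v , i ⁆ a
    ... | inj₁ g = inj₁ g
    ... | inj₂ g with Γ-elim {G = G} {⁅ v , i ⁆} g
    ...   | u , j , uj , e = inj₁ (covers y qy (subst₂ (λ u j → T (adj G j u y))
                               (≡.sym (T-==-elim (T-∧ˡ uj))) (≡.sym (T-==-elim (T-∧ʳ {v == u} uj))) e))
    gain y (just (child u j)) qy a with T-∨-elim {X u j} a
    ... | inj₁ Xuj = inj₁ Xuj
    ... | inj₂ uj with T-==-elim {a = v} {u} (T-∧ˡ uj) | T-==-elim {a = i} {j} (T-∧ʳ {v == u} uj)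
    ...   | refl | refl = inj₂ (isChild-self v i)
    overloaded : w v i ≤ children q v i
    overloaded = +-cancelˡ-≤ (wsum w X) _ _ (begin
      wsum w X + w v i
        ≤⟨ wsum-insert w X v i (absent v i refl) ⟩
      wsum w X+
        ≤⟨ good X+ small ⟩
      supply G q X+
        ≤⟨ count-cover (λ y → gain y (q y) refl) ⟩
      supply G q X + children q v i
        ≤⟨ +-monoˡ-≤ (children q v i) (proj₂ crit) ⟩
      wsum w X + children q v i ∎)

  -- If every free vertex were blocked, one critical set X would have all of them in Γ(X), so all n
  -- vertices would be in use or in a supply of at most 2sD.
  add-seed : ∀ {q} → GoodL q → used q + slack ≤ n →
    ∃ λ x → q x ≡ nothing × GoodL (q [ x ≔ just seed ])
  add-seed {q} good room with label-or-cover seed (λ _ → true) good room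
  ... | inj₁ (x , qx , _ , good') = x , qx , good'
  ... | inj₂ (X , crit@(small , tight) , covers , _) = contradiction room (<⇒≱ (begin-strict
    n
      ≡⟨ ≡.sym (count-all n) ⟩
    count (λ (_ : Fin n) → true)
      ≤⟨ count-cover {q = is-just ∘ q} {λ y → avail G X y (q y)} (λ y _ → cover y (q y) refl) ⟩
    used q + supply G q X
      ≤⟨ +-monoʳ-≤ (used q) (≤-trans tight (≤-trans (wsum≤ w D w≤D X) (*-monoˡ-≤ D small))) ⟩
    used q + 2 * s * D
      <⟨ +-monoʳ-< (used q) (m<m+n (2 * s * D) 1≤s) ⟩
    used q + slack ∎))
    where
    open ≤-Reasoning
    cover : ∀ y l → q y ≡ l → T (is-just l) ⊎ T (avail G X y l)
    cover y (just l) _  = inj₁ tt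
    cover y nothing  qy = inj₂ (covers y qy tt)

  record Served (q : Labelling n t) (i : Fin t) (W : List (Fin n)) : Set where
    field
      q⁺         : Labelling n t
      new        : List (Fin n)
      good       : GoodL q⁺
      sound      : Sound G q⁺
      extends    : q ⊑ q⁺
      length-new : length new ≡ length W
      unique     : Unique new
      origin     : ∀ {x} → x ∈ new → q x ≡ nothing × ∃ λ v → v ∈ W × q⁺ x ≡ just (child v i)
      parents    : ∀ {y v j} → q⁺ y ≡ just (child v j) → q y ≡ just (child v j) ⊎ v ∈ W
      used-bound : used q⁺ ≤ used q + length W

  -- W may repeat vertices. The hypothesis adds the children still requested to those present;
  -- attaching one child moves a unit from the second count to the first.
  serve : ∀ {q} i W → GoodL q → Sound G q → (∀ {v} → v ∈ W → ∃ λ l → q v ≡ just l) →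
          (∀ {v} → v ∈ W → children q v i + mult v W ≤ w v i) →
          used q + length W + slack ≤ n → Served q i W
  serve {q} i [] good sound _ _ _ = record
    { q⁺ = q ; new = [] ; good = good ; sound = sound ; extends = id ; length-new = refl ; unique = []
    ; origin = λ () ; parents = inj₁ ; used-bound = m≤m+n (used q) 0 }
  serve {q} i (v ∷ W) good sound present capacity room
    with add-child {v = v} {i} good
           (≤-trans (+-monoˡ-≤ slack (m≤m+n (used q) _)) room)
           -- The head of the list has multiplicity at least 1, which makes the capacity inequality
           -- strict.
           (≤-trans (≤-reflexive (+-comm 1 _)) (≤-trans
             (+-monoʳ-≤ (children q v i) (≤-trans (≤-reflexive (≡.sym (ind≡1 (T-== v)))) (m≤m+n _ _)))
             (capacity (here refl))))
  ... | x , qx , e , good₁ = record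
    { q⁺ = R.q⁺
    ; new = x ∷ R.new
    ; good = R.good
    ; sound = R.sound
    ; extends = R.extends ∘ ⊑-≔ q qx
    ; length-new = cong suc R.length-new
    ; unique = ¬Any⇒All¬ R.new (λ x∈ → just≢nothing (≔-same q x) (proj₁ (R.origin x∈))) ∷ R.unique
    ; origin = λ { (here refl) → qx , v , here refl , R.extends (≔-same q x)
                 ; (there y∈) → let (q₁y , u , u∈ , q⁺y) = R.origin y∈
                                in ⊑-nothing {f = q} (⊑-≔ q {b = child v i} qx) q₁y , u , there u∈ , q⁺y }
    ; parents = parents
    ; used-bound = ≤-trans R.used-bound (≤-trans (+-monoˡ-≤ (length W) (used-≔ q x _))
                     (≤-reflexive (≡.sym (+-suc (used q) (length W)))))
    }
    where
    q₁ : Labelling n t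
    q₁ = q [ x ≔ just (child v i) ]
    capacity₁ : ∀ {u} → u ∈ W → children q₁ u i + mult u W ≤ w u i
    capacity₁ {u} u∈ = begin
      children q₁ u i + mult u W
        ≤⟨ +-monoˡ-≤ (mult u W) (children-≔ q x v i u) ⟩
      ind (v == u) + children q u i + mult u W
        ≡⟨ cong (_+ mult u W) (+-comm (ind (v == u)) _) ⟩
      children q u i + ind (v == u) + mult u W
        ≡⟨ +-assoc (children q u i) _ _ ⟩
      children q u i + mult u (v ∷ W)
        ≤⟨ capacity (there u∈) ⟩
      w u i ∎
      where open ≤-Reasoning
    module R = Served (serve {q₁} i W good₁ (Sound-≔ sound qx (proj₂ (present (here refl))) e)
      (λ u∈ → _ , ⊑-≔ q qx (proj₂ (present (there u∈)))) capacity₁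
      (≤-trans (+-monoˡ-≤ slack (≤-trans (+-monoˡ-≤ (length W) (used-≔ q x _))
        (≤-reflexive (≡.sym (+-suc (used q) (length W)))))) room))
    parents : ∀ {y u j} → R.q⁺ y ≡ just (child u j) → q y ≡ just (child u j) ⊎ u ∈ v ∷ W
    parents q⁺y with R.parents q⁺y
    ... | inj₂ u∈ = inj₂ (there u∈)
    ... | inj₁ q₁y with ≔-inv q q₁y
    ...   | inj₁ (refl , refl) = inj₂ (here refl)
    ...   | inj₂ qy            = inj₁ qy

  Childless : Labelling n t → Fin n → Set
  Childless q v = ∀ {y i} → q y ≢ just (child v i)

  -- In `branch`, the vertices below the root were free in q, so a single branch can later be added
  -- to q by itself. By `parents`, new children hang only below v or below formerly free vertices;
  -- thus another used vertex that is childless remains so and can be the root of a second tree.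
  record Tree (q : Labelling n t) (v : Fin n) (b : ℕ) (is : List (Fin t)) : Set where
    field
      q⁺         : Labelling n t
      leaves     : List (Fin n)
      good       : GoodL q⁺
      sound      : Sound G q⁺
      extends    : q ⊑ q⁺
      unique     : Unique leaves
      size       : length leaves ≡ b ^ length is
      branch     : ∀ {u} → u ∈ leaves →
                   ∃ λ xs → Branch q⁺ v is xs u × (∀ {x} → x ∈ xs → q x ≡ nothing)
      childless  : ∀ {u} → u ∈ leaves → Childless q⁺ u
      parents    : ∀ {y u j} → q⁺ y ≡ just (child u j) →
                   q y ≡ just (child u j) ⊎ (u ≡ v ⊎ q u ≡ nothing)
      used-bound : used q⁺ ≤ used q + treeSize b (length is)

    leaf-position : ∀ {u} → u ∈ leaves → u ≡ v ⊎ q u ≡ nothing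
    leaf-position u∈ with branch u∈
    ... | xs , br , free with Branch-leaf br
    ...   | inj₁ u≡v = inj₁ u≡v
    ...   | inj₂ u∈xs = inj₂ (free u∈xs)

    leaf-used : ∀ {l} → q v ≡ just l → ∀ {u} → u ∈ leaves → ∃ λ l' → q⁺ u ≡ just l'
    leaf-used qv u∈ with branch u∈
    ... | xs , br , free with Branch-leaf br
    ...   | inj₁ refl = _ , extends qv
    ...   | inj₂ u∈xs = Branch-used br u∈xs

  -- Colours are read from the leaf, so the head of the list belongs to the deepest level and the
  -- recursion on the tail has built all levels above it. Its leaves are childless, so their whole
  -- demand, at least b, is available.
  growTree : ∀ {q v l b} is → GoodL q → Sound G q → q v ≡ just l → Childless q v →
             (∀ i → b ≤ w v i) → (∀ {x} i → q x ≡ nothing → b ≤ w x i) →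
             used q + treeSize b (length is) + slack ≤ n → Tree q v b is
  growTree {q} {v} [] good sound qv childless _ _ _ = record
    { q⁺ = q ; leaves = v ∷ [] ; good = good ; sound = sound ; extends = id ; unique = [] ∷ []
    ; size = refl ; branch = λ { (here refl) → [] , [] , λ () } ; childless = λ { (here refl) → childless }
    ; parents = inj₁ ; used-bound = m≤m+n (used q) 0 }
  growTree {q} {v} {l} {b} (i ∷ is) good sound qv childless roomy-v roomy-free room = record
    { q⁺ = S.q⁺
    ; leaves = S.new
    ; good = S.good
    ; sound = S.sound
    ; extends = S.extends ∘ P.extends
    ; unique = S.unique
    ; size = ≡.trans S.length-new level-size
    ; branch = branch
    ; childless = childless⁺
    ; parents = parents
    ; used-bound = ≤-trans S.used-bound level-used
    }
    where
    module P = Tree (growTree {q} {v} {l} {b} is good sound qv childless roomy-v roomy-free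
      (≤-trans (+-monoˡ-≤ slack (+-monoʳ-≤ (used q) (m≤m+n (treeSize b (length is)) _))) room))
    W : List (Fin n)
    W = copies b P.leaves
    level-size : length W ≡ b ^ suc (length is)
    level-size = ≡.trans (copies-length b P.leaves) (cong (b *_) P.size)
    level-used : used P.q⁺ + length W ≤ used q + treeSize b (suc (length is))
    level-used = ≤-trans (+-mono-≤ P.used-bound (≤-reflexive level-size)) (≤-reflexive (+-assoc (used q) _ _))
    W-used : ∀ {u} → u ∈ W → ∃ λ l' → P.q⁺ u ≡ just l'
    W-used u∈ = P.leaf-used qv (copies-∈ b u∈)
    roomy : ∀ {u} → u ∈ W → b ≤ w u i
    roomy u∈ with P.leaf-position (copies-∈ b u∈)
    ... | inj₁ refl = roomy-v i
    ... | inj₂ qu   = roomy-free i qu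
    capacity : ∀ {u} → u ∈ W → children P.q⁺ u i + mult u W ≤ w u i
    capacity {u} u∈ = ≤-trans
      (≤-reflexive (cong (_+ mult u W) (no-children P.q⁺ λ y → P.childless (copies-∈ b u∈))))
      (≤-trans (copies-mult b u P.unique) (roomy u∈))
    module S = Served (serve i W P.good P.sound W-used capacity
      (≤-trans (+-monoˡ-≤ slack level-used) room))
    branch : ∀ {x} → x ∈ S.new →
             ∃ λ xs → Branch S.q⁺ v (i ∷ is) xs x × (∀ {y} → y ∈ xs → q y ≡ nothing)
    branch {x} x∈ with S.origin x∈
    ... | x-free , u , u∈ , q⁺x with P.branch (copies-∈ b u∈)
    ...   | xs , br , free =
      x ∷ xs ,
      grow (Branch-⊑ S.extends br) q⁺x (λ x∈xs → just≢nothing (proj₂ (Branch-used br x∈xs)) x-free) ,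
      λ { (here refl) → ⊑-nothing {f = q} {P.q⁺} P.extends x-free ; (there y∈) → free y∈ }
    childless⁺ : ∀ {x} → x ∈ S.new → Childless S.q⁺ x
    childless⁺ x∈ q⁺y with S.parents q⁺y
    ... | inj₁ qy   = just≢nothing (proj₂ (closed P.sound qy)) (proj₁ (S.origin x∈))
    ... | inj₂ x∈W  = just≢nothing (proj₂ (W-used x∈W)) (proj₁ (S.origin x∈))
    parents : ∀ {y u j} → S.q⁺ y ≡ just (child u j) → q y ≡ just (child u j) ⊎ (u ≡ v ⊎ q u ≡ nothing)
    parents q⁺y with S.parents q⁺y
    ... | inj₁ qy  = P.parents qy
    ... | inj₂ u∈W = inj₂ (P.leaf-position (copies-∈ b u∈W))

-- The integer-valued R(X,φ)

sumFinℤ-+ : ∀ {k} {f : Fin k → ℤ} {g : Fin k → ℕ} → (∀ i → f i ≡ ℤ.+ g i) → sumFinℤ f ≡ ℤ.+ sumFin g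
sumFinℤ-+ {zero}  _ = refl
sumFinℤ-+ {suc k} e = cong₂ ℤ._+_ (e fz) (sumFinℤ-+ (e ∘ fs))

-- Since no degree exceeds D, truncated subtraction loses nothing.
deficit : ∀ {n t} D (deg : Fin n → Fin t → ℕ) X → (∀ v i → deg v i ≤ D) →
          sumFinℤ (λ v → sumFinℤ (λ i → if X v i then (ℤ.+ D) ℤ.- (ℤ.+ deg v i) else ℤ.+ 0))
          ≡ ℤ.+ wsum (λ v i → D ∸ deg v i) X
deficit D deg X deg≤D = sumFinℤ-+ λ v → sumFinℤ-+ λ i → entry (X v i) (deg≤D v i)
  where
  entry : ∀ x {d} → d ≤ D → (if x then (ℤ.+ D) ℤ.- (ℤ.+ d) else ℤ.+ 0) ≡ ℤ.+ (if x then D ∸ d else 0)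
  entry true  {d} d≤D = ≡.trans (ℤ.m-n≡m⊖n D d) (ℤ.⊖-≥ d≤D)
  entry false     _   = refl

-- The subtracted c will be |P ∩ X|. Discarding it is the step that forgets the given roots.
nonneg-elim : ∀ a {b c z} → z ≡ ℤ.+ b → ℤ.+ 0 ℤ.≤ ((ℤ.+ a) ℤ.- z) ℤ.- (ℤ.+ c) → b ≤ a
nonneg-elim a refl p =
  ℤ.drop‿+≤+ (ℤ.0≤i-j⇒j≤i (ℤ.≤-trans (ℤ.+≤+ z≤n) (ℤ.0≤i-j⇒j≤i p)))

nonneg-intro : ∀ {a b c z} → z ≡ ℤ.+ b → c ≡ 0 → b ≤ a → ℤ.+ 0 ℤ.≤ ((ℤ.+ a) ℤ.- z) ℤ.- (ℤ.+ c)
nonneg-intro refl refl b≤a =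
  subst (ℤ.+ 0 ℤ.≤_) (≡.sym (ℤ.+-identityʳ _)) (ℤ.i≤j⇒0≤j-i (ℤ.+≤+ b≤a))

-- With no non-root vertex the path condition is vacuous, `parent` is a mere placeholder and P is
-- empty; the root set contains any other one.
allRoots : ∀ {m t} (H : ColGraph m t) → Rooting (fullSub H)
allRoots H = record
  { root = λ _ → true ; root⊆V = λ _ _ → tt ; parent = id ; uniquePath = λ _ _ () }

allRoots-P : ∀ {m n t} (H : ColGraph m t) (φ : Fin m → Fin n) (X : Pairs n t) →
             count2 (λ v i → X v i ∧ inP (allRoots H) φ v i) ≡ 0
allRoots-P {m} H φ X = sum2-zero λ v i → vanish (X v i) λ p → proj₂ (anyFin-elim {m} p)
  where
  vanish : ∀ x {y} → ¬ T y → ind (x ∧ y) ≡ 0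
  vanish false         _  = refl
  vanish true  {true}  ¬y = ⊥-elim (¬y tt)
  vanish true  {false} _  = refl

-- The way back from supply to R: counted free vertices lie in Γ(X) outside the image, and counted
-- children are regrouped by their pair in X by exchanging sums.
supply≤ : ∀ {n t} (G : GraphFamily n t) (q : Labelling n t) (occ : Fin n → Bool) X →
          (∀ {y} → q y ≡ nothing → ¬ T (occ y)) →
          supply G q X ≤ count (λ y → Γ G X y ∧ not (occ y)) + wsum (children q) X
supply≤ {n} {t} G q occ X unocc = begin
  supply G q X
    ≤⟨ sumFin-mono (λ y → pointwise y (q y) refl) ⟩
  sumFin (λ y → ind (outside y) + sum2 (share y))
    ≡⟨ sumFin-+ (ind ∘ outside) (λ y → sum2 (share y)) ⟩
  count outside + sumFin (λ y → sum2 (share y))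
    ≡⟨ cong (count outside +_) swap ⟩
  count outside + sum2 (λ v i → sumFin (λ y → share y v i))
    ≤⟨ +-monoʳ-≤ (count outside) (sum2-mono λ v i → collect (X v i) (λ y → ind (isChild v i (q y)))) ⟩
  count outside + wsum (children q) X ∎
  where
  open ≤-Reasoning
  outside : Fin n → Bool
  outside y = Γ G X y ∧ not (occ y)
  share : Fin n → Fin n → Fin t → ℕ
  share y v i = if X v i then ind (isChild v i (q y)) else 0
  swap : sumFin (λ y → sum2 (share y)) ≡ sum2 (λ v i → sumFin (λ y → share y v i))
  swap = ≡.trans (sumFin-swap (λ y v → sumFin (share y v)))
                 (sumFin-cong λ v → sumFin-swap (λ y i → share y v i))
  collect : ∀ {k} x (f : Fin k → ℕ) → sumFin (λ y → if x then f y else 0) ≤ (if x then sumFin f else 0)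
  collect     true  f = ≤-refl
  collect {k} false f = ≤-reflexive (sumFin-zero {k} λ _ → refl)
  pointwise : ∀ y l → q y ≡ l → ind (avail G X y l) ≤ ind (outside y) + sum2 (share y)
  pointwise y nothing qy = m≤n⇒m≤n+o _ (ind-mono {Γ G X y} λ g → T-∧ g (T-not (unocc qy)))
  pointwise y (just seed) qy = z≤n
  pointwise y (just (child v i)) qy = m≤n⇒m≤o+n (ind (outside y)) (≤-trans present (term≤sum2 v i))
    where
    present : ind (X v i) ≤ share y v i
    present with X v i
    ... | false = z≤n
    ... | true  = ≤-reflexive (≡.sym (ind≡1 (subst (T ∘ isChild v i) (≡.sym qy) (isChild-self v i))))

-- Extending good embeddings

last∉ : ∀ {A : Set} {b : A} xs → Unique (xs ++ b ∷ []) → b ∉ xs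
last∉ (x ∷ xs) (x∉ ∷ uniq) (here refl) = All¬⇒¬Any x∉ (∈-++⁺ʳ xs (here refl))
last∉ (x ∷ xs) (x∉ ∷ uniq) (there b∈)  = last∉ xs uniq b∈

module Extension {n t m : ℕ} (G : GraphFamily n t) (s b c : ℕ) (1≤s : 1 ≤ s) (2≤b : 2 ≤ b)
            (ceil : IsCeilLog b s c) (joined : SJoined s G)
            (H : ColGraph m t) (maxdeg : MaxMonDeg≤ H (suc b)) (large : m + 6 * s * suc b ≤ n)
            (H₀ : Sub H) (φ₀ : Fin m → Fin n) (emb₀ : IsEmbedding H₀ G φ₀) where

  D : ℕ
  D = suc b

  -- Only the edges of the initial embedding are subtracted, so the demand stays fixed; edges to
  -- later children are accounted for on the supply side.
  w : Fin n → Fin t → ℕ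
  w v i = D ∸ degPre H₀ φ₀ i v

  w≤D : ∀ v i → w v i ≤ D
  w≤D v i = m∸n≤m D (degPre H₀ φ₀ i v)

  open Goodness G s D 1≤s joined w w≤D

  -- Partial embeddings of `H` and their labellings

  Partial : Set
  Partial = Fin m → Maybe (Fin n)

  -- In `edge`, the child is the image of a vertex outside H₀. Hence the children of a vertex and
  -- the H₀-neighbours of its preimage account for different edges of H.
  record Emb (φ : Partial) (q : Labelling n t) : Set where
    field
      injective : ∀ {a a' v} → φ a ≡ just v → φ a' ≡ just v → a ≡ a'
      base      : ∀ {h} → T (vset H₀ h) → φ h ≡ just (φ₀ h)
      image     : ∀ {v l} → q v ≡ just l → ∃ λ h → φ h ≡ just v
      occupied  : ∀ {h v} → φ h ≡ just v → ∃ λ l → q v ≡ just l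
      edge      : ∀ {y v i} → q y ≡ just (child v i) → ∃₂ λ g h →
                  φ g ≡ just v × φ h ≡ just y × ¬ T (vset H₀ h) × col H g h ≡ just i × T (adj G i v y)
  open Emb

  Emb-sound : ∀ {φ q} → Emb φ q → Sound G q
  Emb-sound emb = record
    { attached = λ qy → let (_ , _ , _ , _ , _ , _ , e) = edge emb qy in e
    ; closed   = λ qy → let (_ , _ , φg , _) = edge emb qy in occupied emb φg }

  Emb-≔ : ∀ {φ q h x} l → Emb φ q → φ h ≡ nothing → q x ≡ nothing →
          (∀ {v i} → l ≡ child v i → ∃ λ g → φ g ≡ just v × col H g h ≡ just i × T (adj G i v x)) →
          Emb (φ [ h ≔ just x ]) (q [ x ≔ just l ])
  Emb-≔ {φ} {q} {h} {x} l emb φh qx joint = record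
    { injective = injective' ; base = λ h∈ → φ⊑φ' (base emb h∈)
    ; image = image' ; occupied = occupied' ; edge = edge' }
    where
    φ' : Partial
    φ' = φ [ h ≔ just x ]
    q' : Labelling n t
    q' = q [ x ≔ just l ]
    φ⊑φ' : φ ⊑ φ'
    φ⊑φ' = ⊑-≔ φ φh
    unhit : ∀ {a} → φ a ≢ just x
    unhit φa = just≢nothing (proj₂ (occupied emb φa)) qx
    injective' : ∀ {a a' v} → φ' a ≡ just v → φ' a' ≡ just v → a ≡ a'
    injective' φ'a φ'a' with ≔-inv φ φ'a | ≔-inv φ φ'a'
    ... | inj₁ (refl , _)    | inj₁ (refl , _)    = refl
    ... | inj₁ (_    , refl) | inj₂ φa'           = contradiction φa' unhit
    ... | inj₂ φa            | inj₁ (_    , refl) = contradiction φa unhit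
    ... | inj₂ φa            | inj₂ φa'           = injective emb φa φa'
    image' : ∀ {v l'} → q' v ≡ just l' → ∃ λ a → φ' a ≡ just v
    image' q'v with ≔-inv q q'v
    ... | inj₁ (refl , _) = h , ≔-same φ h
    ... | inj₂ qv         = let (a , φa) = image emb qv in a , φ⊑φ' φa
    occupied' : ∀ {a v} → φ' a ≡ just v → ∃ λ l' → q' v ≡ just l'
    occupied' φ'a with ≔-inv φ φ'a
    ... | inj₁ (_ , refl) = l , ≔-same q x
    ... | inj₂ φa         = let (l' , qv) = occupied emb φa in l' , ⊑-≔ q qx qv
    edge' : ∀ {y v i} → q' y ≡ just (child v i) → ∃₂ λ g a →
            φ' g ≡ just v × φ' a ≡ just y × ¬ T (vset H₀ a) × col H g a ≡ just i × T (adj G i v y)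
    edge' q'y with ≔-inv q q'y
    ... | inj₁ (refl , refl) = let (g , φg , gh , e) = joint refl in
      g , h , φ⊑φ' φg , ≔-same φ h , (λ h∈ → just≢nothing (base emb h∈) φh) , gh , e
    ... | inj₂ qy = let (g , a , φg , φa , a∉ , ga , e) = edge emb qy in
      g , a , φ⊑φ' φg , φ⊑φ' φa , a∉ , ga , e

  used≤m : ∀ {φ q} → Emb φ q → used q ≤ m
  used≤m {φ} {q} emb = ≤-trans
    (count≤image {r = λ _ → true} φ λ y qy → let (h , φh) = image emb (proj₂ (T-is-just qy)) in h , tt , φh)
    (≤-reflexive (count-all m))

  degPre≤degSub : ∀ {φ q g v} i → Emb φ q → φ g ≡ just v → degPre H₀ φ₀ i v ≤ degSub H₀ i g
  degPre≤degSub {φ} {g = g} {v} i emb φg = ≤-trans (≤-reflexive (sumFin-supported g off)) (on (vset H₀ g ∧ (φ₀ g == v)))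
    where
    on : ∀ p {x} → (if p then x else 0) ≤ x
    on true  = ≤-refl
    on false = z≤n
    off : ∀ h → h ≢ g → (if vset H₀ h ∧ (φ₀ h == v) then degSub H₀ i h else 0) ≡ 0
    off h h≢g with T? (vset H₀ h ∧ (φ₀ h == v))
    ... | yes p = contradiction (injective emb
            (≡.trans (base emb (T-∧ˡ p)) (cong just (T-==-elim (T-∧ʳ {vset H₀ h} p)))) φg) h≢g
    ... | no ¬p with vset H₀ h ∧ (φ₀ h == v)
    ...   | true  = contradiction tt ¬p
    ...   | false = refl

  degPre-unhit : ∀ {φ q v} i → Emb φ q → (∀ h → φ h ≢ just v) → degPre H₀ φ₀ i v ≡ 0
  degPre-unhit {v = v} i emb unhit = sumFin-zero off
    where
    off : ∀ h → (if vset H₀ h ∧ (φ₀ h == v) then degSub H₀ i h else 0) ≡ 0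
    off h with T? (vset H₀ h ∧ (φ₀ h == v))
    ... | yes p = contradiction
            (≡.trans (base emb (T-∧ˡ p)) (cong just (T-==-elim (T-∧ʳ {vset H₀ h} p)))) (unhit h)
    ... | no ¬p with vset H₀ h ∧ (φ₀ h == v)
    ...   | true  = contradiction tt ¬p
    ...   | false = refl

  w-free : ∀ {φ q v} i → Emb φ q → q v ≡ nothing → w v i ≡ D
  w-free i emb qv = cong (D ∸_) (degPre-unhit i emb λ h φh → just≢nothing (proj₂ (occupied emb φh)) qv)

  embeddedDegree : Partial → Fin t → Fin m → ℕ
  embeddedDegree φ i g = count (λ h → is-just (φ h) ∧ isCol (col H g h) i)

  -- Both terms count embedded neighbours of g in colour i: the first those along edges of H₀, which
  -- lie in H₀, the second preimages of children, which do not.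
  degPre+children≤ : ∀ {φ q g v} i → Emb φ q → φ g ≡ just v →
                     degPre H₀ φ₀ i v + children q v i ≤ embeddedDegree φ i g
  degPre+children≤ {φ} {q} {g} {v} i emb φg = ≤-trans
    (+-mono-≤ (degPre≤degSub i emb φg) (count≤image {r = new} φ preimage))
    (count-disjoint old⇒ new⇒ λ h (old , nw) → T-not-elim (T-∧ˡ nw) (proj₂ (e-ends H₀ g h (T-∧ˡ old))))
    where
    new : Fin m → Bool
    new h = not (vset H₀ h) ∧ (is-just (φ h) ∧ isCol (col H g h) i)
    preimage : ∀ y → T (isChild v i (q y)) → ∃ λ h → T (new h) × φ h ≡ just y
    preimage y qy with edge emb (isChild-elim qy)
    ... | g' , h , φg' , φh , h∉ , g'h , _ with injective emb φg φg'
    ...   | refl = h , T-∧ (T-not h∉) (T-∧ (just-T φh) (isCol-intro g'h)) , φh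
    old⇒ : ∀ h → T (eset H₀ g h ∧ isCol (col H g h) i) → T (is-just (φ h) ∧ isCol (col H g h) i)
    old⇒ h old = T-∧ (just-T (base emb (proj₂ (e-ends H₀ g h (T-∧ˡ old))))) (T-∧ʳ {eset H₀ g h} old)
    new⇒ : ∀ h → T (new h) → T (is-just (φ h) ∧ isCol (col H g h) i)
    new⇒ h = T-∧ʳ {not (vset H₀ h)}

  degPre+children≤deg : ∀ {φ q g v} i → Emb φ q → φ g ≡ just v →
                        degPre H₀ φ₀ i v + children q v i ≤ degH H i g
  degPre+children≤deg {φ} {g = g} i emb φg =
    ≤-trans (degPre+children≤ i emb φg) (count-mono λ h → T-∧ʳ {is-just (φ h)})

  -- The neighbour h is not yet embedded, so the embedded neighbours of g in colour i number fewer
  -- than its degree, which is at most D.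
  capacity : ∀ {φ q g h v i} → Emb φ q → φ g ≡ just v → φ h ≡ nothing → col H g h ≡ just i →
             children q v i < w v i
  capacity {φ} {q} {g} {h} {v} {i} emb φg φh gh = m+n≤o⇒m≤o∸n (suc (children q v i)) (begin
    suc (children q v i) + degPre H₀ φ₀ i v
      ≡⟨ cong suc (+-comm (children q v i) _) ⟩
    suc (degPre H₀ φ₀ i v + children q v i)
      ≤⟨ s≤s (degPre+children≤ i emb φg) ⟩
    suc (embeddedDegree φ i g)
      ≡⟨ cong (_+ embeddedDegree φ i g) (≡.sym (count-single h)) ⟩
    count (h ==_) + embeddedDegree φ i g
      ≤⟨ count-disjoint at-h (λ a → T-∧ʳ {is-just (φ a)}) (λ a → disjoint) ⟩
    degH H i g
      ≤⟨ maxdeg i g ⟩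
    D ∎)
    where
    open ≤-Reasoning
    at-h : ∀ a → T (h == a) → T (isCol (col H g a) i)
    at-h a h==a with T-==-elim {a = h} {a} h==a
    ... | refl = isCol-intro gh
    disjoint : ∀ {a} → ¬ (T (h == a) × T (is-just (φ a) ∧ isCol (col H g a) i))
    disjoint {a} (h==a , p) with T-==-elim {a = h} {a} h==a
    ... | refl = just≢nothing (proj₂ (T-is-just (T-∧ˡ p))) φh

  -- Realized edges and walks

  Real : Partial → Fin m → Fin m → Set
  Real φ a b = ∀ i → col H a b ≡ just i → ∃₂ λ v u → φ a ≡ just v × φ b ≡ just u × T (adj G i v u)

  Real-sym : ∀ {φ a b} → Real φ a b → Real φ b a
  Real-sym {a = a} {b} real i ba with real i (≡.trans (csym H a b) ba)
  ... | v , u , φa , φb , e = u , v , φb , φa , subst T (GraphFamily.sym G i v u) e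

  Real-⊑ : ∀ {φ φ' a b} → φ ⊑ φ' → Real φ a b → Real φ' a b
  Real-⊑ φ⊑φ' real i ab with real i ab
  ... | v , u , φa , φb , e = v , u , φ⊑φ' φa , φ⊑φ' φb , e

  Real-intro : ∀ {φ a b i v u} → col H a b ≡ just i → φ a ≡ just v → φ b ≡ just u → T (adj G i v u) →
               Real φ a b
  Real-intro ab φa φb e j ab' with ≡.trans (≡.sym ab) ab'
  ... | refl = _ , _ , φa , φb , e

  -- Walks in H from a fixed vertex; vertices (other than the first) and colours are listed from the end.
  data Walk (a : Fin m) : List (Fin m) → List (Fin t) → Fin m → Set where
    []   : Walk a [] [] a
    step : ∀ {hs is g h i} → Walk a hs is g → col H g h ≡ just i → h ∉ hs → Walk a (h ∷ hs) (i ∷ is) h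

  Realized : ∀ {a hs is x} → Partial → Walk a hs is x → Set
  Realized φ [] = ⊤
  Realized φ (step {g = g} {h} walk _ _) = Realized φ walk × Real φ g h

  Realized-⊑ : ∀ {φ φ' a hs is x} → φ ⊑ φ' → (walk : Walk a hs is x) → Realized φ walk → Realized φ' walk
  Realized-⊑ φ⊑φ' [] _ = tt
  Realized-⊑ {φ' = φ'} φ⊑φ' (step walk _ _) (r , e) = Realized-⊑ φ⊑φ' walk r , Real-⊑ {φ' = φ'} φ⊑φ' e

  Walk-colours : ∀ {a hs is x} → Walk a hs is x → length is ≡ length hs
  Walk-colours []              = refl
  Walk-colours (step walk _ _) = cong suc (Walk-colours walk)

  -- `upper`, with the k vertices nearest the end, will be read off a tree; `lower` is embedded
  -- vertex by vertex and leads to the root of that tree.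
  record Split (k : ℕ) {a hs is x} (walk : Walk a hs is x) : Set where
    field
      {mid}         : Fin m
      {hs₁ hs₂}     : List (Fin m)
      {is₁ is₂}     : List (Fin t)
      lower         : Walk a hs₂ is₂ mid
      upper         : Walk mid hs₁ is₁ x
      ⊆₁            : ∀ {h} → h ∈ hs₁ → h ∈ hs
      ⊆₂            : ∀ {h} → h ∈ hs₂ → h ∈ hs
      disjoint      : ∀ {h} → h ∈ hs₁ → h ∉ hs₂
      length₁       : length is₁ ≡ k
      length₂       : length hs ≡ k + length hs₂
      join          : ∀ {φ} → Realized φ lower → Realized φ upper → Realized φ walk

  split : ∀ k {a hs is x} (walk : Walk a hs is x) → k ≤ length hs → Split k walk
  split zero walk _ = record
    { lower = walk ; upper = [] ; ⊆₁ = λ () ; ⊆₂ = id ; disjoint = λ () ; length₁ = refl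
    ; length₂ = refl ; join = λ r _ → r }
  split (suc k) (step walk e h∉) (s≤s k≤) = record
    { lower = S.lower
    ; upper = step S.upper e (h∉ ∘ S.⊆₁)
    ; ⊆₁ = λ { (here refl) → here refl ; (there h∈) → there (S.⊆₁ h∈) }
    ; ⊆₂ = there ∘ S.⊆₂
    ; disjoint = λ { (here refl) → h∉ ∘ S.⊆₂ ; (there h∈) → S.disjoint h∈ }
    ; length₁ = cong suc S.length₁
    ; length₂ = cong suc S.length₂
    ; join = λ { r (r' , e) → S.join r r' , e }
    }
    where module S = Split (split k walk k≤)

  -- Embedding single vertices and walks

  record Stage : Set where
    constructor stage
    field
      {φ}  : Partial
      {q}  : Labelling n t
      emb  : Emb φ q
      good : GoodL q
  open Stage

  -- The origin of 6sD. By minimality of c, b^(c-1) < s when c > 0, so each tree adds at most 2bs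
  -- vertices; then 4bs for both trees, 2sD + s for `slack` and 3s to spare make 6s(b + 1).
  growth-room : m + treeSize b c + treeSize b c + slack ≤ n
  growth-room = ≤-trans (≤-reflexive (≡.trans (cong (_+ slack) (+-assoc m _ _)) (+-assoc m _ slack)))
    (≤-trans (+-monoʳ-≤ m (begin
    treeSize b c + treeSize b c + slack
      ≤⟨ +-monoˡ-≤ slack (+-mono-≤ (tree-bound c (proj₂ ceil)) (tree-bound c (proj₂ ceil))) ⟩
    2 * (b * s) + 2 * (b * s) + (2 * s * suc b + s)
      ≤⟨ m≤m+n _ (3 * s) ⟩
    2 * (b * s) + 2 * (b * s) + (2 * s * suc b + s) + 3 * s
      ≡⟨ arithmetic b s ⟩
    6 * s * suc b ∎)) large)
    where
    open ≤-Reasoning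
    arithmetic : ∀ b s → 2 * (b * s) + 2 * (b * s) + (2 * s * suc b + s) + 3 * s ≡ 6 * s * suc b
    arithmetic = solve-∀
    tree-bound : ∀ k → (∀ j → s ≤ b ^ j → k ≤ j) → treeSize b k ≤ 2 * (b * s)
    tree-bound zero    _       = z≤n
    tree-bound (suc k) minimal = ≤-trans (treeSize≤ 2≤b (suc k))
      (*-monoʳ-≤ 2 (*-monoʳ-≤ b (<⇒≤ (≰⇒> λ s≤ → 1+n≰n (minimal k s≤)))))

  room : ∀ {φ q} → Emb φ q → used q + slack ≤ n
  room emb = ≤-trans (+-monoˡ-≤ slack (≤-trans (used≤m emb)
    (≤-trans (m≤m+n m (treeSize b c)) (m≤m+n _ (treeSize b c))))) growth-room

  record Attached (S : Stage) (g h : Fin m) : Set where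
    field
      next      : Stage
      v'        : Fin n
      extends   : φ S ⊑ φ next
      q-extends : q S ⊑ q next
      elsewhere : ∀ {a} → a ≢ h → φ next a ≡ φ S a
      at        : φ next h ≡ just v'
      was-free  : q S v' ≡ nothing
      real      : Real (φ next) g h
      childless : Childless (q next) v'
      keeps     : ∀ {u} → φ S g ≢ just u → Childless (q S) u → Childless (q next) u

  attach : ∀ (S : Stage) {g h v i} → φ S g ≡ just v → φ S h ≡ nothing → col H g h ≡ just i → Attached S g h
  attach S {g} {h} {v} {i} φg φh gh with add-child (good S) (room (emb S)) (capacity (emb S) φg φh gh)
  ... | x , qx , e , good' = record
    { next = stage (Emb-≔ (child v i) (emb S) φh qx λ { refl → g , φg , gh , e }) good'
    ; v' = x
    ; extends = ⊑-≔ (φ S) φh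
    ; q-extends = ⊑-≔ (q S) qx
    ; elsewhere = ≔-other (φ S)
    ; at = ≔-same (φ S) h
    ; was-free = qx
    ; real = Real-intro gh (⊑-≔ (φ S) φh φg) (≔-same (φ S) h) e
    ; childless = λ q'y → case-childless (≔-inv (q S) q'y)
    ; keeps = λ φg≢ u-childless q'y → case-keeps φg≢ u-childless (≔-inv (q S) q'y)
    }
    where
    case-childless : ∀ {y j} → (y ≡ x × child v i ≡ child x j) ⊎ q S y ≡ just (child x j) → ⊥
    case-childless (inj₁ (_ , refl)) = just≢nothing (proj₂ (occupied (emb S) φg)) qx
    case-childless (inj₂ qy)         = just≢nothing (proj₂ (closed (Emb-sound (emb S)) qy)) qx
    case-keeps : ∀ {u y j} → φ S g ≢ just u → Childless (q S) u →
                 (y ≡ x × child v i ≡ child u j) ⊎ q S y ≡ just (child u j) → ⊥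
    case-keeps φg≢ _ (inj₁ (_ , refl)) = φg≢ φg
    case-keeps _ u-childless (inj₂ qy) = u-childless qy

  record Seeded (S : Stage) (h : Fin m) : Set where
    field
      next      : Stage
      v'        : Fin n
      extends   : φ S ⊑ φ next
      elsewhere : ∀ {a} → a ≢ h → φ next a ≡ φ S a
      at        : φ next h ≡ just v'

  ensure : ∀ S h → Seeded S h
  ensure S h with nothing? (φ S h)
  ... | inj₂ (v , φh) = record { next = S ; v' = v ; extends = id ; elsewhere = λ _ → refl ; at = φh }
  ... | inj₁ φh with add-seed (good S) (room (emb S))
  ...   | x , qx , good' = record
    { next = stage (Emb-≔ seed (emb S) φh qx λ ()) good'
    ; v' = x
    ; extends = ⊑-≔ (φ S) φh
    ; elsewhere = ≔-other (φ S)
    ; at = ≔-same (φ S) h }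

  -- The last two fields prepare the roots of the trees: by `fresh` the end of a nonempty walk was
  -- free and has no children, and by `keeps` embedding the second walk leaves the end of the first
  -- childless.
  record Walked (S : Stage) {a hs is x} (walk : Walk a hs is x) : Set where
    field
      next      : Stage
      v'        : Fin n
      extends   : φ S ⊑ φ next
      q-extends : q S ⊑ q next
      elsewhere : ∀ {h} → h ∉ hs → φ next h ≡ φ S h
      at        : φ next x ≡ just v'
      realized  : Realized (φ next) walk
      keeps     : ∀ {u l} → q S u ≡ just l → φ S a ≢ just u → Childless (q S) u → Childless (q next) u
      fresh     : 0 < length hs → q S v' ≡ nothing × Childless (q next) v'

  embedWalk : ∀ S {a hs is x v} (walk : Walk a hs is x) → φ S a ≡ just v →
              (∀ {h} → h ∈ hs → φ S h ≡ nothing) → Walked S walk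
  embedWalk S [] φa _ = record
    { next = S ; v' = _ ; extends = id ; q-extends = id ; elsewhere = λ _ → refl ; at = φa
    ; realized = tt ; keeps = λ _ _ → id ; fresh = λ () }
  embedWalk S {a} {h ∷ hs} {v = v} (step {g = g} walk e h∉) φa undefined = record
    { next = A.next
    ; v' = A.v'
    ; extends = A.extends ∘ W.extends
    ; q-extends = A.q-extends ∘ W.q-extends
    ; elsewhere = λ a∉ → ≡.trans (A.elsewhere (a∉ ∘ here)) (W.elsewhere (a∉ ∘ there))
    ; at = A.at
    ; realized = Realized-⊑ {φ' = φ A.next} A.extends walk W.realized , A.real
    ; keeps = λ qu φa≢u childless → A.keeps (parent-differs walk W.at W.fresh qu φa≢u) (W.keeps qu φa≢u childless)
    ; fresh = λ _ → ⊑-nothing {f = q S} {q W.next} W.q-extends A.was-free , A.childless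
    }
    where
    module W = Walked (embedWalk S walk φa (undefined ∘ there))
    module A = Attached (attach W.next W.at (≡.trans (W.elsewhere h∉) (undefined (here refl))) e)
    -- The vertex receiving the next child is either the image of a, which is not u by assumption,
    -- or was free in S, whereas u was in use.
    parent-differs : ∀ {hs is g u l} → Walk a hs is g → φ W.next g ≡ just W.v' →
                     (0 < length hs → q S W.v' ≡ nothing × Childless (q W.next) W.v') →
                     q S u ≡ just l → φ S a ≢ just u → φ W.next g ≢ just u
    parent-differs [] at _ qu φa≢u φg≡u = φa≢u (≡.trans φa (≡.trans (≡.sym (W.extends φa)) φg≡u))
    parent-differs (step _ _ _) at fresh qu φa≢u φg≡u with ≡.trans (≡.sym at) φg≡u
    ... | refl = just≢nothing qu (proj₁ (fresh (s≤s z≤n)))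

  -- Branches of trees and the joining of two walks

  record Replayed (φ : Partial) (q q̂ : Labelling n t) {a hs is x} (walk : Walk a hs is x)
                  (xs : List (Fin n)) (u : Fin n) : Set where
    field
      {φ'}        : Partial
      {q'}        : Labelling n t
      emb'        : Emb φ' q'
      extends     : φ ⊑ φ'
      elsewhere   : ∀ {h} → h ∉ hs → φ' h ≡ φ h
      below       : q' ⊑ q̂
      q-elsewhere : ∀ {y} → y ∉ xs → q' y ≡ q y
      at          : φ' x ≡ just u
      realized    : Realized φ' walk

  -- Instead of deleting the rest of the trees from q̂, the branch alone is added to q with the
  -- labels it has in q̂. Walk and branch have the same colours, and since the result stays below
  -- q̂, its goodness follows at the end from `GoodL-⊑`.
  replay : ∀ {φ q q̂ a hs is x v xs u} → Emb φ q → q ⊑ q̂ → Sound G q̂ →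
           (walk : Walk a hs is x) → Branch q̂ v is xs u → φ a ≡ just v →
           (∀ {h} → h ∈ hs → φ h ≡ nothing) → (∀ {y} → y ∈ xs → q y ≡ nothing) →
           Replayed φ q q̂ walk xs u
  replay emb q⊑q̂ sound [] [] φa _ _ = record
    { emb' = emb ; extends = id ; elsewhere = λ _ → refl ; below = q⊑q̂ ; q-elsewhere = λ _ → refl
    ; at = φa ; realized = tt }
  replay {φ} {q} {q̂} emb q⊑q̂ sound (step {g = g} {h} walk gh h∉)
         (grow {u = u} {i} {x} br q̂x x∉) φa undefined free = record
    { emb' = Emb-≔ (child u i) R.emb' φ'h q'x λ { refl → g , R.at , gh , attached sound q̂x }
    ; extends = ⊑-≔ R.φ' φ'h ∘ R.extends
    ; elsewhere = λ a∉ → ≡.trans (≔-other R.φ' (a∉ ∘ here)) (R.elsewhere (a∉ ∘ there))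
    ; below = below
    ; q-elsewhere = λ y∉ → ≡.trans (≔-other R.q' (y∉ ∘ here)) (R.q-elsewhere (y∉ ∘ there))
    ; at = ≔-same R.φ' h
    ; realized = Realized-⊑ {φ' = R.φ' [ h ≔ just x ]} (⊑-≔ R.φ' φ'h) walk R.realized ,
                 Real-intro {φ = R.φ' [ h ≔ just x ]} gh (⊑-≔ R.φ' φ'h R.at) (≔-same R.φ' h) (attached sound q̂x)
    }
    where
    module R = Replayed (replay emb q⊑q̂ sound walk br φa (undefined ∘ there) (free ∘ there))
    φ'h : R.φ' h ≡ nothing
    φ'h = ≡.trans (R.elsewhere h∉) (undefined (here refl))
    q'x : R.q' x ≡ nothing
    q'x = ≡.trans (R.q-elsewhere x∉) (free (here refl))
    below : (R.q' [ x ≔ just (child u i) ]) ⊑ q̂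
    below q''y with ≔-inv R.q' q''y
    ... | inj₁ (refl , refl) = q̂x
    ... | inj₂ q'y           = R.below q'y

  record Connected (S : Stage) {a a' hsA isA x hsB isB y} (walkA : Walk a hsA isA x)
                   (walkB : Walk a' hsB isB y) : Set where
    field
      next      : Stage
      extends   : φ S ⊑ φ next
      elsewhere : ∀ {h} → h ∉ hsA → h ∉ hsB → φ next h ≡ φ S h
      realizedA : Realized (φ next) walkA
      realizedB : Realized (φ next) walkB
      real      : Real (φ next) x y

  finish : ∀ S {a a' hsA is₁ x hsB is₂ y μ xs ys u v q₂} (walkA : Walk a hsA is₁ x) (walkB : Walk a' hsB is₂ y) →
           col H x y ≡ just μ → T (adj G μ u v) → Sound G q₂ → GoodL q₂ →
           (RA : Replayed (φ S) (q S) q₂ walkA xs u) →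
           Replayed (Replayed.φ' RA) (Replayed.q' RA) q₂ walkB ys v → Connected S walkA walkB
  finish S walkA walkB xy e sound₂ good₂ RA RB = record
    { next = stage RB.emb' (GoodL-⊑ sound₂ RB.below good₂)
    ; extends = RB.extends ∘ RA.extends
    ; elsewhere = λ h∉A h∉B → ≡.trans (RB.elsewhere h∉B) (RA.elsewhere h∉A)
    ; realizedA = Realized-⊑ {φ' = RB.φ'} RB.extends walkA RA.realized
    ; realizedB = RB.realized
    ; real = Real-intro {φ = RB.φ'} xy (RB.extends RA.at) RB.at e }
    where
    module RA = Replayed RA
    module RB = Replayed RB

  joinTrees : ∀ S {a a' hsA is₁ x hsB is₂ y μ vA vB} (walkA : Walk a hsA is₁ x) (walkB : Walk a' hsB is₂ y) →
    col H x y ≡ just μ → φ S a ≡ just vA → φ S a' ≡ just vB →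
    (∀ {h} → h ∈ hsA → φ S h ≡ nothing) → (∀ {h} → h ∈ hsB → φ S h ≡ nothing) →
    (∀ {h} → h ∈ hsA → h ∉ hsB) → length is₁ ≡ c → length is₂ ≡ c →
    (TA : Tree (q S) vA b is₁) → Tree (Tree.q⁺ TA) vB b is₂ → Connected S walkA walkB
  joinTrees S {is₁ = is₁} {is₂ = is₂} {μ = μ} {vA} {vB} walkA walkB xy φa φa' undefinedA undefinedB disjoint
            length₁ length₂ TA TB = conclude (joined X (mem TB.leaves) X-large Y-large)
    where
    module TA = Tree TA
    module TB = Tree TB
    -- All pairs in X carry the colour μ of the edge still missing, so the edge given by joinedness
    -- has that colour.
    X : Pairs n t
    X u i = mem TA.leaves u ∧ (μ == i)
    many : ∀ {L k} → Unique L → length L ≡ b ^ k → k ≡ c → s ≤ count (mem L)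
    many uniq size refl = ≤-trans (proj₁ ceil) (≤-trans (≤-reflexive (≡.sym size)) (length≤count uniq))
    X-large : s ≤ count2 X
    X-large = ≤-trans (many TA.unique TA.size length₁)
      (sumFin-mono λ u → ≤-trans (ind-mono {mem TA.leaves u} {X u μ} (λ u∈ → T-∧ u∈ (T-== μ)))
                                 (term≤sumFin {f = λ i → ind (X u i)} μ))
    Y-large : s ≤ count (mem TB.leaves)
    Y-large = many TB.unique TB.size length₂
    conclude : (∃ λ u → ∃ λ i → ∃ λ v → T (X u i) × T (mem TB.leaves v) × T (adj G i u v)) →
               Connected S walkA walkB
    conclude (u , i , v , Xui , v∈ , e)
      with TA.branch (mem-elim {L = TA.leaves} (T-∧ˡ Xui)) | TB.branch (mem-elim {L = TB.leaves} v∈)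
    ... | xs , brA , freeA | ys , brB , freeB = finish S walkA walkB xy
      (subst (λ j → T (adj G j u v)) (≡.sym (T-==-elim {a = μ} {i} (T-∧ʳ {mem TA.leaves u} Xui))) e)
      TB.sound TB.good RA (replayB RA)
      where
      RA : Replayed (φ S) (q S) TB.q⁺ walkA xs u
      RA = replay (emb S) (TB.extends ∘ TA.extends) TB.sound walkA (Branch-⊑ TB.extends brA) φa undefinedA freeA
      replayB : (R : Replayed (φ S) (q S) TB.q⁺ walkA xs u) →
                Replayed (Replayed.φ' R) (Replayed.q' R) TB.q⁺ walkB ys v
      replayB R = replay R.emb' R.below TB.sound walkB brB (R.extends φa')
        (λ h∈ → ≡.trans (R.elsewhere (λ h∈' → disjoint h∈' h∈)) (undefinedB h∈))
        -- The branches are disjoint: the second consists of vertices that were still free after the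
        -- first tree was grown.
        (λ z∈ → ≡.trans (R.q-elsewhere (λ z∈' → just≢nothing (proj₂ (Branch-used brA z∈')) (freeB z∈)))
                  (⊑-nothing {f = q S} {TA.q⁺} TA.extends (freeB z∈)))
        where module R = Replayed R

  connectFresh : ∀ S {a a' hsA is₁ x hsB is₂ y μ vA vB} (walkA : Walk a hsA is₁ x) (walkB : Walk a' hsB is₂ y) →
    col H x y ≡ just μ → φ S a ≡ just vA → φ S a' ≡ just vB → vB ≢ vA →
    Childless (q S) vA → Childless (q S) vB → (∀ i → b ≤ w vA i) → (∀ i → b ≤ w vB i) →
    (∀ {h} → h ∈ hsA → φ S h ≡ nothing) → (∀ {h} → h ∈ hsB → φ S h ≡ nothing) →
    (∀ {h} → h ∈ hsA → h ∉ hsB) → length is₁ ≡ c → length is₂ ≡ c → Connected S walkA walkB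
  connectFresh S {is₁ = is₁} {is₂ = is₂} {vA = vA} {vB} walkA walkB xy φa φa' vB≢vA childlessA childlessB roomyA roomyB
               undefinedA undefinedB disjoint length₁ length₂ = second first
    where
    roomy : ∀ {v} i → q S v ≡ nothing → b ≤ w v i
    roomy i qv = ≤-trans (n≤1+n b) (≤-reflexive (≡.sym (w-free i (emb S) qv)))
    first : Tree (q S) vA b is₁
    first = growTree is₁ (good S) (Emb-sound (emb S)) (proj₂ (occupied (emb S) φa)) childlessA roomyA roomy
      (≤-trans (+-monoˡ-≤ slack (≤-trans
        (+-mono-≤ (used≤m (emb S)) (≤-reflexive (cong (treeSize b) length₁)))
        (m≤m+n _ (treeSize b c)))) growth-room)
    second : Tree (q S) vA b is₁ → Connected S walkA walkB
    second TA = joinTrees S walkA walkB xy φa φa' undefinedA undefinedB disjoint length₁ length₂ TA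
      (growTree is₂ TA.good TA.sound (TA.extends (proj₂ usedB)) childlessB' roomyB
        (λ i free → roomy i (⊑-nothing {f = q S} {TA.q⁺} TA.extends free))
        (≤-trans (+-monoˡ-≤ slack (+-mono-≤
          (≤-trans TA.used-bound (+-mono-≤ (used≤m (emb S)) (≤-reflexive (cong (treeSize b) length₁))))
          (≤-reflexive (cong (treeSize b) length₂)))) growth-room))
      where
      module TA = Tree TA
      usedB : ∃ λ l → q S vB ≡ just l
      usedB = occupied (emb S) φa'
      -- The first tree hangs children only below its root and below vertices that were free, and vB
      -- is neither.
      childlessB' : Childless TA.q⁺ vB
      childlessB' q⁺y with TA.parents q⁺y
      ... | inj₁ qy          = childlessB qy
      ... | inj₂ (inj₁ e)    = vB≢vA e
      ... | inj₂ (inj₂ free) = just≢nothing (proj₂ usedB) free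

  -- The first parts of both walks are embedded edge by edge; the last c vertices of each are found in
  -- two b-ary trees, whose unused vertices are freed again once two leaves are joined.
  connect : ∀ S {a a' hsA isA x hsB isB y μ vA vB} (walkA : Walk a hsA isA x) (walkB : Walk a' hsB isB y) →
    col H x y ≡ just μ → φ S a ≡ just vA → φ S a' ≡ just vB →
    c < length hsA → c < length hsB →
    (∀ {h} → h ∈ hsA → φ S h ≡ nothing) → (∀ {h} → h ∈ hsB → φ S h ≡ nothing) →
    (∀ {h} → h ∈ hsA → h ∉ hsB) → Connected S walkA walkB
  connect S {a} {a'} walkA walkB xy φa φa' longA longB undefinedA undefinedB disjoint =
    afterA (embedWalk S SA.lower φa (undefinedA ∘ SA.⊆₂))
    where
    module SA = Split (split c walkA (<⇒≤ longA))
    module SB = Split (split c walkB (<⇒≤ longB))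
    -- Having more than c vertices, each walk keeps at least one after its last c are split off; so
    -- each tree is rooted at a fresh vertex, not at a given end of the path.
    positive : ∀ {k l} → k ≡ c + l → c < k → 0 < l
    positive {l = l} refl c< = +-cancelˡ-< c 0 l (≤-trans (s≤s (≤-reflexive (+-identityʳ c))) c<)

    afterB : (LA : Walked S SA.lower) → Walked (Walked.next LA) SB.lower → Connected S walkA walkB
    afterB LA LB = combine (connectFresh LB.next SA.upper SB.upper xy (LB.extends LA.at) LB.at distinct
        (LB.keeps (proj₂ usedA) a'-differs (proj₂ freshA)) (proj₂ freshB)
        (λ i → roomy i (emb S) (proj₁ freshA)) (λ i → roomy i (emb LA.next) (proj₁ freshB))
        (λ h∈ → ≡.trans (LB.elsewhere (λ h∈' → disjoint (SA.⊆₁ h∈) (SB.⊆₂ h∈')))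
                  (≡.trans (LA.elsewhere (SA.disjoint h∈)) (undefinedA (SA.⊆₁ h∈))))
        (λ h∈ → ≡.trans (LB.elsewhere (SB.disjoint h∈))
                  (≡.trans (LA.elsewhere (λ h∈' → disjoint (SA.⊆₂ h∈') (SB.⊆₁ h∈))) (undefinedB (SB.⊆₁ h∈))))
        (λ h∈A h∈B → disjoint (SA.⊆₁ h∈A) (SB.⊆₁ h∈B)) SA.length₁ SB.length₁)
      where
      module LA = Walked LA
      module LB = Walked LB
      freshA : q S LA.v' ≡ nothing × Childless (q LA.next) LA.v'
      freshA = LA.fresh (positive SA.length₂ longA)
      freshB : q LA.next LB.v' ≡ nothing × Childless (q LB.next) LB.v'
      freshB = LB.fresh (positive SB.length₂ longB)
      usedA : ∃ λ l → q LA.next LA.v' ≡ just l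
      usedA = occupied (emb LA.next) LA.at
      a'-differs : φ LA.next a' ≢ just LA.v'
      a'-differs e with ≡.trans (≡.sym e) (LA.extends φa')
      ... | refl = just≢nothing (proj₂ (occupied (emb S) φa')) (proj₁ freshA)
      distinct : LB.v' ≢ LA.v'
      distinct e = just≢nothing (proj₂ usedA) (subst (λ v → q LA.next v ≡ nothing) e (proj₁ freshB))
      roomy : ∀ {φ' q' v} i → Emb φ' q' → q' v ≡ nothing → b ≤ w v i
      roomy i emb' q'v = ≤-trans (n≤1+n b) (≤-reflexive (≡.sym (w-free i emb' q'v)))
      combine : Connected LB.next SA.upper SB.upper → Connected S walkA walkB
      combine C = record
        { next = C.next
        ; extends = C.extends ∘ LB.extends ∘ LA.extends
        ; elsewhere = λ h∉A h∉B → ≡.trans (C.elsewhere (h∉A ∘ SA.⊆₁) (h∉B ∘ SB.⊆₁))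
            (≡.trans (LB.elsewhere (h∉B ∘ SB.⊆₂)) (LA.elsewhere (h∉A ∘ SA.⊆₂)))
        ; realizedA = SA.join (Realized-⊑ {φ' = φ C.next} (C.extends ∘ LB.extends) SA.lower LA.realized) C.realizedA
        ; realizedB = SB.join (Realized-⊑ {φ' = φ C.next} C.extends SB.lower LB.realized) C.realizedB
        ; real = C.real }
        where module C = Connected C

    afterA : Walked S SA.lower → Connected S walkA walkB
    afterA LA = afterB LA (embedWalk LA.next SB.lower (LA.extends φa')
      (λ h∈ → ≡.trans (LA.elsewhere (λ h∈' → disjoint (SA.⊆₂ h∈') (SB.⊆₂ h∈))) (undefinedB (SB.⊆₂ h∈))))
      where module LA = Walked LA

  -- Cutting and embedding a path

  AllReal : Partial → List (Fin m × Fin m) → Set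
  AllReal φ = All (λ e → Real φ (proj₁ e) (proj₂ e))

  -- This is the cut at the first edge of the path. As walks list their vertices from the end,
  -- `inner` in path order is already the list of the walk that starts at z.
  record RightWalk (g : Fin m) (inner : List (Fin m)) (z : Fin m) : Set where
    field
      {is}    : List (Fin t)
      {y}     : Fin m
      {μ}     : Fin t
      walk    : Walk z inner is y
      joint   : col H g y ≡ just μ
      realize : ∀ {φ} → Realized φ walk → Real φ g y → AllReal φ (pairs (g ∷ inner ++ z ∷ []))

  rightWalk : ∀ g inner z → Unique (inner ++ z ∷ []) →
              All (λ e → IsEdge H (proj₁ e) (proj₂ e)) (pairs (g ∷ inner ++ z ∷ [])) → RightWalk g inner z
  rightWalk g [] z _ (gz ∷ _) = record
    { walk = [] ; joint = proj₂ (T-is-just gz) ; realize = λ _ r → r ∷ [] }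
  rightWalk g (h ∷ inner) z (h∉ ∷ uniq) (gh ∷ es) = record
    { walk = step W.walk (≡.trans (csym H W.y h) W.joint) (λ h∈ → All¬⇒¬Any h∉ (∈-++⁺ˡ h∈))
    ; joint = proj₂ (T-is-just gh)
    ; realize = λ {φ} (rs , yh) gh' → gh' ∷ W.realize {φ} rs (Real-sym {φ} yh) }
    where module W = RightWalk (rightWalk h inner z uniq es)

  -- A path from a to z cut at one of its edges xy, both pieces being read towards the cut.
  record Cut (a : Fin m) (inner : List (Fin m)) (z : Fin m) : Set₁ where
    field
      {hsA hsB} : List (Fin m)
      {isA isB} : List (Fin t)
      {x y}     : Fin m
      {μ}       : Fin t
      walkA     : Walk a hsA isA x
      walkB     : Walk z hsB isB y
      joint     : col H x y ≡ just μ
      disjoint  : ∀ {h} → h ∈ hsA → h ∉ hsB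
      ⊆A        : ∀ {h} → h ∈ hsA → h ∈ inner
      ⊆B        : ∀ {h} → h ∈ hsB → h ∈ inner
      realize   : ∀ {φ} → Realized φ walkA → Realized φ walkB → Real φ x y →
                  AllReal φ (pairs (a ∷ inner ++ z ∷ []))

  -- Each step moves the cut one edge towards z: the old cut edge prolongs the walk from a, and the
  -- last edge of the walk from z becomes the new cut edge.
  moveCut : ∀ {a inner z} d {e f} (C : Cut a inner z) → length (Cut.hsB C) ≡ d + e → length (Cut.hsA C) ≡ f →
            ∃ λ (C' : Cut a inner z) → length (Cut.hsB C') ≡ e × length (Cut.hsA C') ≡ d + f
  moveCut zero C lenB lenA = C , lenB , lenA
  moveCut (suc d) record { walkA = walkA ; walkB = step {hs} {g = y'} {h = y} walkB e y∉ ; joint = joint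
                         ; disjoint = disjoint ; ⊆A = ⊆A ; ⊆B = ⊆B ; realize = realize } lenB refl =
    let (C' , lenB' , lenA') = moveCut d moved (cong (_∸ 1) lenB) refl
    in C' , lenB' , ≡.trans lenA' (+-suc d _)
    where
    moved : Cut _ _ _
    moved = record
      { walkA = step walkA joint (λ y∈ → disjoint y∈ (here refl))
      ; walkB = walkB
      ; joint = ≡.trans (csym H y y') e
      ; disjoint = λ { (here refl) → y∉ ; (there h∈) → disjoint h∈ ∘ there }
      ; ⊆A = λ { (here refl) → ⊆B (here refl) ; (there h∈) → ⊆A h∈ }
      ; ⊆B = ⊆B ∘ there
      ; realize = λ {φ} (rA , xy) rB yy' → realize {φ} rA (rB , Real-sym {φ} yy') xy }

  record Extended (S : Stage) (p : PathData m) : Set where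
    field
      next      : Stage
      extends   : φ S ⊑ φ next
      elsewhere : ∀ {h} → h ∉ pverts p → φ next h ≡ φ S h
      realized  : AllReal (φ next) (pairs (pverts p))

  embedInterior : ∀ S p {vA vB} → IsPathIn H p → 2 * c + 3 ≤ plength p → φ S (start p) ≡ just vA →
                  φ S (end p) ≡ just vB → (∀ {h} → h ∈ inner p → φ S h ≡ nothing) → Extended S p
  embedInterior S p (_ ∷ uniq , es) long φa φz undefined = useCut (moveCut d initial lengthB refl)
    where
    module W = RightWalk (rightWalk (start p) (inner p) (end p) uniq es)
    d : ℕ
    -- The side of `end p` keeps c + 1 inner vertices. The other side gets the remaining d, again at
    -- least c + 1, since a path of length at least 2c + 3 has at least 2c + 2 inner vertices.
    d = length (inner p) ∸ suc c
    longer : suc c + suc c ≤ length (inner p)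
    longer = +-cancelˡ-≤ 1 _ _ (≤-trans (≤-reflexive (count-vertices c)) long)
      where
      count-vertices : ∀ c → 1 + (suc c + suc c) ≡ 2 * c + 3
      count-vertices = solve-∀
    initial : Cut (start p) (inner p) (end p)
    initial = record
      { walkA = [] ; walkB = W.walk ; joint = W.joint ; disjoint = λ () ; ⊆A = λ () ; ⊆B = id
      ; realize = λ {φ} _ rB r → W.realize {φ} rB r }
    lengthB : length (inner p) ≡ d + suc c
    lengthB = ≡.sym (m∸n+n≡m (m+n≤o⇒m≤o (suc c) longer))
    useCut : (∃ λ (C : Cut (start p) (inner p) (end p)) →
              length (Cut.hsB C) ≡ suc c × length (Cut.hsA C) ≡ d + 0) → Extended S p
    useCut (C , lenB , lenA) = extended (connect S C.walkA C.walkB C.joint φa φz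
        (≤-trans (m+n≤o⇒m≤o∸n (suc c) longer) (≤-reflexive (≡.sym (≡.trans lenA (+-identityʳ d)))))
        (≤-reflexive (≡.sym lenB)) (undefined ∘ C.⊆A) (undefined ∘ C.⊆B) C.disjoint)
      where
      module C = Cut C
      interior : ∀ {h} → h ∈ inner p → h ∈ pverts p
      interior = there ∘ ∈-++⁺ˡ
      extended : Connected S C.walkA C.walkB → Extended S p
      extended R = record
        { next = R.next ; extends = R.extends
        ; elsewhere = λ h∉ → R.elsewhere (h∉ ∘ interior ∘ C.⊆A) (h∉ ∘ interior ∘ C.⊆B)
        ; realized = C.realize {φ R.next} R.realizedA R.realizedB R.real }
        where module R = Connected R

  embedPath : ∀ S p → IsPathIn H p → 2 * c + 3 ≤ plength p → (∀ {h} → h ∈ inner p → φ S h ≡ nothing) →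
              Extended S p
  embedPath S p path@(a∉ ∷ uniq , _) long undefined = first (ensure S (start p))
    where
    second : (A : Seeded S (start p)) → Seeded (Seeded.next A) (end p) → Extended S p
    second A Z = combine (embedInterior Z.next p path long (Z.extends A.at) Z.at λ h∈ →
        ≡.trans (Z.elsewhere λ { refl → last∉ (inner p) uniq h∈ })
          (≡.trans (A.elsewhere λ { refl → All¬⇒¬Any a∉ (∈-++⁺ˡ h∈) }) (undefined h∈)))
      where
      module A = Seeded A
      module Z = Seeded Z
      combine : Extended Z.next p → Extended S p
      combine R = record
        { next = R.next
        ; extends = R.extends ∘ Z.extends ∘ A.extends
        ; elsewhere = λ h∉ → ≡.trans (R.elsewhere h∉) (≡.trans
            (Z.elsewhere λ { refl → h∉ (there (∈-++⁺ʳ (inner p) (here refl))) })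
            (A.elsewhere λ { refl → h∉ (here refl) }))
        ; realized = R.realized }
        where module R = Extended R
    first : Seeded S (start p) → Extended S p
    first A = second A (ensure (Seeded.next A) (end p))

  -- Passing through all paths

  record Progress {k : ℕ} (P : Fin k → PathData m) (i : ℕ) : Set where
    field
      current : Stage
      -- Nothing outside H₀ and the earlier paths is embedded; constructibility then says that the
      -- inner vertices of the next path are not.
      defined : ∀ {h v} → φ current h ≡ just v →
                T (vset H₀ h) ⊎ Σ (Fin k) λ j → (toℕ j < i) × (h ∈ pverts (P j))
      done    : ∀ {j} → toℕ j < i → AllReal (φ current) (pairs (pverts (P j)))

  module _ {k : ℕ} (P : Fin k → PathData m) (paths : ∀ j → IsPathIn H (P j))
           (long : ∀ j → 2 * c + 3 ≤ plength (P j))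
           (inner-new : ∀ j h → h ∈ inner (P j) →
                        ¬ (T (vset H₀ h) ⊎ Σ (Fin k) λ j' → (toℕ j' < toℕ j) × (h ∈ pverts (P j')))) where

    advance : ∀ {i} → i < k → Progress P i → Progress P (suc i)
    advance {i} i<k Pr = continue (embedPath Pr.current (P j) (paths j) (long j) undefined)
      where
      module Pr = Progress Pr
      j : Fin k
      j = fromℕ< i<k
      j≡i : toℕ j ≡ i
      j≡i = toℕ-fromℕ< i<k
      undefined : ∀ {h} → h ∈ inner (P j) → φ Pr.current h ≡ nothing
      undefined {h} h∈ with nothing? (φ Pr.current h)
      ... | inj₁ φh       = φh
      ... | inj₂ (v , φh) = ⊥-elim (inner-new j h h∈ (subst
              (λ l → T (vset H₀ h) ⊎ Σ (Fin k) λ j' → (toℕ j' < l) × (h ∈ pverts (P j'))) (≡.sym j≡i) (Pr.defined φh)))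
      continue : Extended Pr.current (P j) → Progress P (suc i)
      continue E = record { current = E.next ; defined = defined' ; done = done' }
        where
        module E = Extended E
        defined' : ∀ {h v} → φ E.next h ≡ just v →
                   T (vset H₀ h) ⊎ Σ (Fin k) λ j' → (toℕ j' < suc i) × (h ∈ pverts (P j'))
        defined' {h} φh with mem? _≟_ h (pverts (P j))
        ... | yes h∈ = inj₂ (j , ≤-reflexive (cong suc j≡i) , h∈)
        ... | no  h∉ with Pr.defined (≡.trans (≡.sym (E.elsewhere h∉)) φh)
        ...   | inj₁ h∈             = inj₁ h∈
        ...   | inj₂ (j' , j'<i , h∈) = inj₂ (j' , m<n⇒m<1+n j'<i , h∈)
        done' : ∀ {j'} → toℕ j' < suc i → AllReal (φ E.next) (pairs (pverts (P j')))
        done' {j'} j'<1+i with m≤n⇒m<n∨m≡n (≤-pred j'<1+i)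
        ... | inj₁ j'<i = All.map (Real-⊑ {φ' = φ E.next} E.extends) (Pr.done j'<i)
        ... | inj₂ j'≡i with toℕ-injective (≡.trans j'≡i (≡.sym j≡i))
        ...   | refl = E.realized

    run : ∀ i → i ≤ k → Progress P 0 → Progress P i
    run zero    _   Pr = Pr
    run (suc i) i<k Pr = advance i<k (run i (<⇒≤ i<k) Pr)

  -- Constructibility covers the edges of H, so isolated vertices may lie outside H₀ and all paths;
  -- they become seeds.
  fill : ∀ S hs → ∃ λ S' → φ S ⊑ φ S' × (∀ {h} → h ∈ hs → ∃ λ v → φ S' h ≡ just v)
  fill S []       = S , id , λ ()
  fill S (h ∷ hs) with ensure S h
  ... | A with fill (Seeded.next A) hs
  ...   | S' , extends , defined = S' , (λ φa → extends (Seeded.extends A φa)) ,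
    λ { (here refl) → _ , extends (Seeded.at A) ; (there h∈) → defined h∈ }

  -- The initial embedding

  φ-init : Partial
  φ-init h = if vset H₀ h then just (φ₀ h) else nothing

  -- The whole image of H₀ consists of seeds, because the edges of H₀ are already subtracted in `w`.
  q-init : Labelling n t
  q-init v = if inImage H₀ φ₀ v then just seed else nothing

  φ-init-inv : ∀ {h v} → φ-init h ≡ just v → T (vset H₀ h) × φ₀ h ≡ v
  φ-init-inv {h} e with vset H₀ h
  φ-init-inv refl | true = tt , refl

  q-init-inv : ∀ {v l} → q-init v ≡ just l → T (inImage H₀ φ₀ v) × l ≡ seed
  q-init-inv {v} e with inImage H₀ φ₀ v
  q-init-inv refl | true = tt , refl

  φ-init-base : ∀ {h} → T (vset H₀ h) → φ-init h ≡ just (φ₀ h)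
  φ-init-base {h} h∈ with vset H₀ h
  ... | true = refl

  q-init-used : ∀ {v} → T (inImage H₀ φ₀ v) → q-init v ≡ just seed
  q-init-used {v} v∈ with inImage H₀ φ₀ v
  ... | true = refl

  init-emb : Emb φ-init q-init
  init-emb = record
    { injective = injective'
    ; base = φ-init-base
    ; image = image'
    ; occupied = occupied'
    ; edge = λ qy → contradiction (proj₂ (q-init-inv qy)) λ () }
    where
    injective' : ∀ {a a' v} → φ-init a ≡ just v → φ-init a' ≡ just v → a ≡ a'
    injective' {a} {a'} φa φa' with φ-init-inv φa | φ-init-inv φa'
    ... | a∈ , refl | a'∈ , e = inj emb₀ a a' a∈ a'∈ (≡.sym e)
    image' : ∀ {v l} → q-init v ≡ just l → ∃ λ h → φ-init h ≡ just v
    image' qv with anyFin-elim (proj₁ (q-init-inv qv))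
    ... | h , p = h , ≡.trans (φ-init-base (T-∧ˡ p)) (cong just (T-==-elim (T-∧ʳ {vset H₀ h} p)))
    occupied' : ∀ {h v} → φ-init h ≡ just v → ∃ λ l → q-init v ≡ just l
    occupied' {h} φh with φ-init-inv φh
    ... | h∈ , refl = seed , q-init-used (anyFin-intro h (T-∧ h∈ (T-== (φ₀ h))))

  degPre₀≤D : ∀ v i → degPre H₀ φ₀ i v ≤ D
  degPre₀≤D v i with nothing? (q-init v)
  ... | inj₁ qv = ≤-trans (≤-reflexive (degPre-unhit i init-emb λ h φh →
                    just≢nothing (proj₂ (occupied init-emb φh)) qv)) z≤n
  ... | inj₂ (l , qv) with image init-emb qv
  ...   | g , φg = ≤-trans (m+n≤o⇒m≤o _ (degPre+children≤deg i init-emb φg)) (maxdeg i g)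

  -- There are no children yet, so the supply of X is the part of Γ(X) outside the image and the
  -- demand is the sum in R(X,φ).
  init-good : ∀ (R₀ : Rooting H₀) → Good R₀ G φ₀ (2 * s) D → GoodL q-init
  init-good R₀ good X small = ≤-trans
    (nonneg-elim (count (λ y → Γ G X y ∧ not (inImage H₀ φ₀ y)))
      (deficit D (λ v i → degPre H₀ φ₀ i v) X degPre₀≤D) (good X small))
    (count-mono λ y → free y)
    where
    free : ∀ y → T (Γ G X y ∧ not (inImage H₀ φ₀ y)) → T (avail G X y (q-init y))
    free y p with inImage H₀ φ₀ y
    ... | true  = ⊥-elim (T-∧ʳ {Γ G X y} p)
    ... | false = T-∧ˡ p

  -- From the labelling back to R(X,φ)

  module Total (S : Stage) (total : ∀ h → ∃ λ v → φ S h ≡ just v) where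

    φ' : Fin m → Fin n
    φ' h = proj₁ (total h)

    φ'-base : ∀ h → T (vset H₀ h) → φ' h ≡ φ₀ h
    φ'-base h h∈ = just-injective (≡.trans (≡.sym (proj₂ (total h))) (base (emb S) h∈))

    φ'-injective : ∀ {a a'} → φ' a ≡ φ' a' → a ≡ a'
    φ'-injective {a} {a'} e =
      injective (emb S) (proj₂ (total a)) (≡.trans (proj₂ (total a')) (cong just (≡.sym e)))

    deg' : Fin n → Fin t → ℕ
    deg' v i = degPre (fullSub H) φ' i v

    deg'-hit : ∀ g i → deg' (φ' g) i ≡ degSub (fullSub H) i g
    deg'-hit g i = ≡.trans (sumFin-supported g off) on
      where
      off : ∀ h → h ≢ g → (if true ∧ (φ' h == φ' g) then degSub (fullSub H) i h else 0) ≡ 0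
      off h h≢g with φ' h ≟ φ' g
      ... | yes e = contradiction (φ'-injective e) h≢g
      ... | no  _ = refl
      on : (if true ∧ (φ' g == φ' g) then degSub (fullSub H) i g else 0) ≡ degSub (fullSub H) i g
      on with φ' g ≟ φ' g
      ... | yes _  = refl
      ... | no  ¬e = contradiction refl ¬e

    deg'-unhit : ∀ {v} i → (∀ h → φ' h ≢ v) → deg' v i ≡ 0
    deg'-unhit {v} i unhit = sumFin-zero off
      where
      off : ∀ h → (if true ∧ (φ' h == v) then degSub (fullSub H) i h else 0) ≡ 0
      off h with φ' h ≟ v
      ... | yes e = contradiction e (unhit h)
      ... | no  _ = refl

    degSub≤ : ∀ i g → degSub (fullSub H) i g ≤ degH H i g
    degSub≤ i g = count-mono λ h → T-∧ʳ {is-just (col H g h)}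

    ≤degSub : ∀ i g → degH H i g ≤ degSub (fullSub H) i g
    ≤degSub i g = count-mono {p = λ h → isCol (col H g h) i} {λ h → is-just (col H g h) ∧ isCol (col H g h) i} λ h gh → T-∧ (just-T (isCol-elim gh)) gh

    hit? : ∀ v → (∃ λ g → φ' g ≡ v) ⊎ (q S v ≡ nothing × (∀ h → φ S h ≢ just v))
    hit? v with nothing? (q S v)
    ... | inj₁ qv = inj₂ (qv , λ h φh → just≢nothing (proj₂ (occupied (emb S) φh)) qv)
    ... | inj₂ (l , qv) with image (emb S) qv
    ...   | g , φg = inj₁ (g , just-injective (≡.trans (≡.sym (proj₂ (total g))) φg))

    unhit' : ∀ {v} → (∀ h → φ S h ≢ just v) → ∀ h → φ' h ≢ v
    unhit' unhit h refl = unhit h (proj₂ (total h))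

    deg'≤D : ∀ v i → deg' v i ≤ D
    deg'≤D v i with hit? v
    ... | inj₁ (g , refl)    = ≤-trans (≤-reflexive (deg'-hit g i)) (≤-trans (degSub≤ i g) (maxdeg i g))
    ... | inj₂ (_ , unhit) = ≤-trans (≤-reflexive (deg'-unhit i (unhit' unhit))) z≤n

    degPre+children≤deg' : ∀ v i → degPre H₀ φ₀ i v + children (q S) v i ≤ deg' v i
    degPre+children≤deg' v i with hit? v
    ... | inj₁ (g , refl) = ≤-trans (degPre+children≤deg i (emb S) (proj₂ (total g)))
      (≤-trans (≤degSub i g) (≤-reflexive (≡.sym (deg'-hit g i))))
    ... | inj₂ (_ , unhit) = ≤-trans (≤-reflexive (cong₂ _+_ (degPre-unhit i (emb S) unhit)
      (no-children (q S) λ y qy → let (g , _ , φg , _) = edge (emb S) qy in unhit g φg))) z≤n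

    -- The degree in H is at least the degree in H₀ plus the number of children. Further edges at v,
    -- such as the one to its own parent or one that closes a path, only lower the left side.
    deficit+children≤w : ∀ v i → D ∸ deg' v i + children (q S) v i ≤ w v i
    deficit+children≤w v i = m+n≤o⇒m≤o∸n _ (begin
      D ∸ deg' v i + children (q S) v i + degPre H₀ φ₀ i v
        ≡⟨ +-assoc (D ∸ deg' v i) _ _ ⟩
      D ∸ deg' v i + (children (q S) v i + degPre H₀ φ₀ i v)
        ≤⟨ +-monoʳ-≤ (D ∸ deg' v i) (≤-trans (≤-reflexive (+-comm (children (q S) v i) _))
                                             (degPre+children≤deg' v i)) ⟩
      D ∸ deg' v i + deg' v i
        ≡⟨ m∸n+n≡m (deg'≤D v i) ⟩
      D ∎)
      where open ≤-Reasoning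

    -- The children in X occur on both sides, once within the demand and once within the supply;
    -- cancelling them leaves the inequality R(X,φ') ≥ 0 with P empty.
    final-good : Good (allRoots H) G φ' (2 * s) D
    final-good X small = nonneg-intro (deficit D deg' X deg'≤D) (allRoots-P H φ' X)
      (+-cancelʳ-≤ (wsum (children (q S)) X) _ _ (begin
        wsum (λ v i → D ∸ deg' v i) X + wsum (children (q S)) X
          ≡⟨ ≡.sym (wsum-+ (λ v i → D ∸ deg' v i) (children (q S)) X) ⟩
        wsum (λ v i → D ∸ deg' v i + children (q S) v i) X
          ≤⟨ wsum-mono deficit+children≤w X ⟩
        wsum w X
          ≤⟨ good S X small ⟩
        supply G (q S) X
          ≤⟨ supply≤ G (q S) (inImage (fullSub H) φ') X free ⟩
        count (λ y → Γ G X y ∧ not (inImage (fullSub H) φ' y)) + wsum (children (q S)) X ∎))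
      where
      open ≤-Reasoning
      free : ∀ {y} → q S y ≡ nothing → ¬ T (inImage (fullSub H) φ' y)
      free qy y∈ with anyFin-elim {m} y∈
      ... | h , e with T-==-elim {a = φ' h} e
      ...   | refl = just≢nothing (proj₂ (occupied (emb S) (proj₂ (total h)))) qy

    Real-total : ∀ {a a'} i → Real (φ S) a a' → col H a a' ≡ just i → T (adj G i (φ' a) (φ' a'))
    Real-total {a} {a'} i real aa' with real i aa'
    ... | v , u , φa , φa' , e = subst₂ (λ v u → T (adj G i v u))
      (just-injective (≡.trans (≡.sym φa) (proj₂ (total a))))
      (just-injective (≡.trans (≡.sym φa') (proj₂ (total a')))) e

  theorem : (R₀ : Rooting H₀) → PathConstructible H H₀ (2 * c + 3) → Good R₀ G φ₀ (2 * s) D →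
    Σ (Rooting (fullSub H)) λ R → (∀ h → T (root R₀ h) → T (root R h)) ×
    Σ (Fin m → Fin n) λ φ' → IsEmbedding (fullSub H) G φ' × Good R G φ' (2 * s) D ×
    (∀ h → T (vset H₀ h) → φ' h ≡ φ₀ h)
  theorem R₀ (k , P , paths , long , _ , covered , inner-new , _) good₀ = complete (run P paths long inner-new k ≤-refl initial)
    where
    initial : Progress P 0
    initial = record
      { current = stage init-emb (init-good R₀ good₀)
      ; defined = λ φh → inj₁ (proj₁ (φ-init-inv φh))
      ; done = λ () }
    complete : Progress P k → _
    complete Pr with fill (Progress.current Pr) (allFin m)
    ... | S , extends , defined = allRoots H , (λ _ _ → tt) , φ' ,
      record { inj = λ a a' _ _ → φ'-injective ; edges = edges' } , final-good , φ'-base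
      where
      open Total S (λ h → defined (∈-allFin h))
      edges' : ∀ a a' i → IsEdge H a a' → col H a a' ≡ just i → T (adj G i (φ' a) (φ' a'))
      edges' a a' i aa' coloured with proj₁ (covered a a') aa'
      ... | inj₁ e₀ = let (a∈ , a'∈) = e-ends H₀ a a' e₀ in
        subst₂ (λ v u → T (adj G i v u)) (≡.sym (φ'-base a a∈)) (≡.sym (φ'-base a' a'∈))
          (edges emb₀ a a' i e₀ coloured)
      ... | inj₂ (j , inj₁ e∈) = Real-total i
        (Real-⊑ {φ' = φ S} extends (All.lookup (Progress.done Pr (toℕ<n j)) e∈)) coloured
      ... | inj₂ (j , inj₂ e∈) = Real-total i
        (Real-sym {φ S} (Real-⊑ {φ' = φ S} extends (All.lookup (Progress.done Pr (toℕ<n j)) e∈))) coloured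

theorem2p12 : (s t D n m c : ℕ) → 1 ≤ s → 1 ≤ t → 3 ≤ D →
    IsCeilLog (D ∸ 1) s c →
    (G : GraphFamily n t) → SJoined s G →
    (H : ColGraph m t) → MaxMonDeg≤ H D → m + 6 * s * D ≤ n →
    (H₀ : Sub H) (R₀ : Rooting H₀) →
    PathConstructible H H₀ (2 * c + 3) →
    (φ : Fin m → Fin n) → IsEmbedding H₀ G φ → Good R₀ G φ (2 * s) D →
    Σ (Rooting (fullSub H)) λ R →
    (∀ h → T (root R₀ h) → T (root R h)) ×
    Σ (Fin m → Fin n) λ φ' →
    IsEmbedding (fullSub H) G φ' × Good R G φ' (2 * s) D ×
    (∀ h → T (vset H₀ h) → φ' h ≡ φ h)
theorem2p12 s t (suc b) n m c 1≤s _ (s≤s 2≤b) ceil G joined H maxdeg large H₀ R₀ constructible φ emb good =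
  Extension.theorem G s b c 1≤s 2≤b ceil joined H maxdeg large H₀ φ emb R₀ constructible good
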